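{- Let $G$ be a simple loony endgame with exactly one 3-chain and at least one chain of length 4 or more, and let $c=cv(G)$. (a) If $c\ge2$ then $v(G)=c$. (b) If $c\le1$ and $c$ is even, then $v(G)=2$, except if $G$ has a 4-loop and $cv(G\backslash 4_\ell)=4$, in which case $v(G)=0$. (c) If $c\le1$ is odd and $v(G\backslash 3)=2$, then $v(G)=1$. (d) If $c\le1$ is odd, $v(G\backslash 3)\ne2$ and $G$ has no 4-loops, then $v(G)=3$. (e) If $c\le1$ is odd, $v(G\backslash3)\ne2$ and $G$ has $f\ge1$ 4-loops, let $K$ denote $G$ with all its 4-loops removed, and let $d$ be the integer with $0\le d\le7$ and $d\equiv v(K)\pmod 8$. If $f$ is odd then $v(G)=|4-d|$, and if $f$ is even then $v(G)=4-|4-d|$.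
   Context: Game. A dots and boxes game (position) $G$ consists of a finite set of unclaimed boxes and a finite set of undrawn lines, each undrawn line bordering either exactly one box or exactly two distinct boxes, each box being bordered by at least one and at most four undrawn lines. Two players play. The player to move draws (removes) an undrawn line; every box none of whose bordering lines is still undrawn is then claimed by that player. If the move claims at least one box the same player must move again (if a line remains); otherwise the other player moves. Claiming a box when possible is not compulsory. The game ends when no line remains. Each player maximises (own boxes) minus (opponent's boxes), counting only boxes claimed from $G$ onwards. Value. $v(G)$ is the net score, under optimal play, of the player who is NOT to move in $G$. Equivalently, $v(G)=0$ if $G$ has no undrawn lines, and otherwise $v(G)=\min_m v(G;m)$ over undrawn lines $m$, where, if drawing $m$ claims $k$ boxes and leaves the position $G_m$, then $v(G;m)=v(G_m)-k$ if $k\ge1$ and $v(G;m)=-v(G_m)$ if $k=0$. Chains and loops. An $n$-chain (denoted $n$) has boxes $b_1,\dots,b_n$ and lines $e_0,\dots,e_n$, where $e_i$ borders $b_i,b_{i+1}$ for $1\le i\le n-1$, $e_0$ borders only $b_1$ and $e_n$ borders only $b_n$. An $n$-loop ($n\ge4$, denoted $n_\ell$) has boxes $b_1,\dots,b_n$ and lines $e_1,\dots,e_n$, $e_i$ bordering $b_i,b_{i+1}$ (indices mod $n$). A simple loony endgame is a finite (possibly empty) disjoint union of chains of length at least 3 and loops of even length at least 4. $G\backslash 3$ (resp. $G\backslash 4_\ell$) is $G$ with one 3-chain (resp. one 4-loop) removed. Controlled value. If $G$ is a simple loony endgame with chains of lengths $c_i$ and loops of lengths $\ell_j$, then $fcv(G)=\sum_i(c_i-4)+\sum_j(\ell_j-8)$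 and $cv(G)=fcv(G)+tb(G)$, where the terminal bonus $tb(G)$ is: $0$ if $G$ is empty; $4$ if $G$ is non-empty and has a chain of length at least 4 or has no loops; $8$ if $G$ has loops but no chains; $6$ if $G$ has both chains and loops and all its chains are 3-chains. -}

module Defs where

open import Data.Bool.Base using (_∨_)
open import Data.Fin.Base using (Fin; toℕ)
open import Data.Fin.Properties using (nonZeroIndex)
open import Data.Fin.Subset using (Subset; ⊥; ⁅_⁆; _∪_; _─_; ∣_∣)
open import Data.Integer.Base using (ℤ; +_; -_; 0ℤ; _+_; _-_; _⊓_)
import Data.List.Base as List
open import Data.List.Base using (List; []; _∷_; length; filter)
open import Data.List.Membership.Propositional using (_∈_)
open import Data.List.Relation.Unary.All using (All)
import Data.List.Relation.Unary.All.Properties as All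
open import Data.List.Relation.Unary.Any using (any?)
import Data.List.Relation.Unary.Any as Any
open import Data.Nat.Base as ℕ using (ℕ; zero; suc; _≤_)
open import Data.Nat.Divisibility using (_∣_)
open import Data.Nat.DivMod using (_mod_)
open import Data.Nat.Properties using (_≟_; _≤?_)
open import Data.Product.Base using (_×_)
open import Data.Vec.Base using (Vec; []; _∷_; _++_; foldr₁; map; removeAt; tabulate)
import Data.Vec.Base as Vec
open import Relation.Nullary using (does; ¬?; yes; no)

------------------------------------------------------------------------
-- Positions

-- Each of the m undrawn lines is represented by the set of boxes it borders.
-- Drawing lines does not renumber the boxes: the unclaimed boxes are those
-- bordered by at least one undrawn line, and other elements of Fin n are
-- boxes that have already been claimed. The rules below do not depend on the
-- bounds on the number of boxes per line or lines per box; in chains and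
-- loops every line borders one or two boxes and every box has two lines.
Lines : ℕ → ℕ → Set
Lines n m = Vec (Subset n) m

unclaimed : ∀ {n m} → Lines n m → Subset n
unclaimed = Vec.foldr _ _∪_ ⊥

claimedBy : ∀ {n m} → Lines n (suc m) → Fin (suc m) → Subset n
claimedBy G i = unclaimed G ─ unclaimed (removeAt G i)

-- Given the number k of boxes claimed by a move and the value of the
-- resulting position, the value of making that move.
moveValue : ℕ → ℤ → ℤ
moveValue zero      w = - w
moveValue k@(suc _) w = w - + k

-- The net score of the player not to move.
value : ∀ {n m} → Lines n m → ℤ
value {m = zero}  _ = 0ℤ
value {m = suc _} G =
  foldr₁ _⊓_ (tabulate λ i → moveValue ∣ claimedBy G i ∣ (value (removeAt G i)))

record Position : Set where
  constructor position
  field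
    {boxes} : ℕ
    {size}  : ℕ
    lines   : Lines boxes size

open Position public

∅ : Position
∅ = position {0} []

infixr 6 _⊎_

_⊎_ : Position → Position → Position
G ⊎ H = position (map (_++ ⊥) (lines G) ++ map (⊥ ++_) (lines H))

-- The element j of Fin n stands for the box b_{j+1}, so the line e_i borders
-- it exactly when i = j or i = j + 1. In particular e_0 and e_n each border
-- a single box.
chain : ℕ → Position
chain n = position (tabulate {n = suc n} λ i → tabulate {n = n} λ j →
  does (toℕ i ≟ toℕ j) ∨ does (toℕ i ≟ suc (toℕ j)))

loop : ℕ → Position
loop n = position (tabulate {n = n} λ i → ⁅ i ⁆ ∪ ⁅ next i ⁆)
  where
  next : Fin n → Fin n
  next i = _mod_ (suc (toℕ i)) n {{nonZeroIndex i}}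

------------------------------------------------------------------------
-- Simple loony endgames

record SimpleLoonyEndgame : Set where
  constructor endgame
  field
    chains   : List ℕ
    loops    : List ℕ
    chains≥3 : All (3 ≤_) chains
    loopsOK  : All (λ ℓ → 4 ≤ ℓ × 2 ∣ ℓ) loops

open SimpleLoonyEndgame public

toPosition : SimpleLoonyEndgame → Position
toPosition G = union (List.map chain (chains G)) ⊎ union (List.map loop (loops G))
  where
  union : List Position → Position
  union = List.foldr _⊎_ ∅

v : SimpleLoonyEndgame → ℤ
v G = value (lines (toPosition G))

infixl 6 _∖chain_ _∖loop_

_∖chain_ : ∀ {n} (G : SimpleLoonyEndgame) → n ∈ chains G → SimpleLoonyEndgame
endgame cs ls cs≥3 ok ∖chain c∈cs =
  endgame (cs Any.─ c∈cs) ls (All.─⁺ c∈cs cs≥3) ok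

_∖loop_ : ∀ {n} (G : SimpleLoonyEndgame) → n ∈ loops G → SimpleLoonyEndgame
endgame cs ls cs≥3 ok ∖loop ℓ∈ls =
  endgame cs (ls Any.─ ℓ∈ls) cs≥3 (All.─⁺ ℓ∈ls ok)

withoutLoops : ℕ → SimpleLoonyEndgame → SimpleLoonyEndgame
withoutLoops n (endgame cs ls cs≥3 ok) =
  endgame cs (filter others ls) cs≥3 (All.filter⁺ others ok)
  where others = λ ℓ → ¬? (ℓ ≟ n)

numberOf : ℕ → List ℕ → ℕ
numberOf n xs = length (filter (_≟ n) xs)

------------------------------------------------------------------------
-- Controlled value

∑ : List ℤ → ℤ
∑ = List.foldr _+_ 0ℤ

fcv : SimpleLoonyEndgame → ℤ
fcv G = ∑ (List.map (λ c → + c - + 4) (chains G))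
      + ∑ (List.map (λ ℓ → + ℓ - + 8) (loops G))

-- Since chains have length at least 3, having no chain of length at least 4
-- means that all chains are 3-chains.
terminalBonus : (chains loops : List ℕ) → ℤ
terminalBonus []         []      = + 0
terminalBonus []         (_ ∷ _) = + 8
terminalBonus (_ ∷ _)    []      = + 4
terminalBonus cs@(_ ∷ _) (_ ∷ _) with any? (4 ≤?_) cs
... | yes _ = + 4
... | no  _ = + 6

tb : SimpleLoonyEndgame → ℤ
tb G = terminalBonus (chains G) (loops G)

cv : SimpleLoonyEndgame → ℤ
cv G = fcv G + tb G

{-# OPTIONS --safe #-}

-- Measure a position by ζ = (unclaimed boxes) + value, twice the number of boxes the player not
-- to move will get. A move that claims a box leaves ζ unchanged, and any other move replaces it
-- by 2T − ζ, where T is the number of unclaimed boxes. Let a component of n boxes be opened next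
-- to a rest R of value x. The opponent can take all n boxes one by one; or stop two boxes (for a
-- chain) or four boxes (for a loop) before the end and hand these over, so that the opener has to
-- move first in R. No other reply is better, because lines that can all be drawn with a capture
-- in a suitable order keep this property when any of them is removed. So opening a chain is worth
-- n − 2 + |x − 2| and opening a loop n − 4 + |x − 4|, and v is the minimum of these numbers.
--
-- The rest is arithmetic for endgames with a chain of length at least 4. Put κ = fcv + 4, which
-- is then cv. Always κ ≤ v, and v ≡ κ modulo 2. If there is at most one 3-chain and κ ≥ 2 then
-- v = κ. If κ ≤ 1 then opening a 4-loop or a 6-loop shows v ≤ 4 when there is no 3-chain, and
-- opening the 3-chain shows v ≤ 3 when there is just one. Only the openings of a 3-chain or of a
-- 4-loop can be worth less than 2, so the few possible values can be told apart by removing the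
-- 3-chain, or the 4-loops one at a time.
module Submission where

open import Defs
open import Data.Bool.Base using (Bool; true; false; _∨_)
open import Data.Empty as Empty using (⊥-elim)
open import Data.Fin.Base as Fin using (Fin; zero; suc; toℕ; inject₁; fromℕ; _↑ˡ_; _↑ʳ_)
import Data.Fin.Properties as Fin
open import Data.Fin.Subset
  using (Subset; ⊥; ⁅_⁆; _∪_; _─_; ⋃; _⊆_; _⊈_; _∉_; inside; outside)
  renaming (_∈_ to _∈ˢ_; ∣_∣ to card)
import Data.Fin.Subset.Properties as Subset
open import Data.Integer.Base
  using (ℤ; +_; -[1+_]; -_; _+_; _-_; _*_; _≤_; _⊓_; ∣_∣; +≤+; -≤+)
open import Data.Integer.Divisibility using (_∣_)
import Data.Integer.Divisibility.Signed as Signed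
open import Data.Integer.DivMod using (_%ℕ_)
import Data.Integer.Properties as ℤ
open import Data.Integer.Tactic.RingSolver using (solve-∀)
open import Data.List.Base as List
  using (List; []; _∷_; _++_; length; map; concatMap; filter; allFin)
import Data.List.Properties as List
import Data.Nat.Properties as ℕ
open import Data.List.Membership.DecPropositional ℕ._≟_ using (_∈?_)
open import Data.List.Membership.Propositional using (_∈_; find)
import Data.List.Membership.Propositional.Properties as Mem
import Data.List.Relation.Binary.Permutation.Propositional as ↭
open ↭ using (_↭_; ↭-refl; ↭-sym; ↭-trans; ↭-reflexive)
import Data.List.Relation.Binary.Permutation.Propositional.Properties as ↭
import Data.List.Relation.Binary.Permutation.Setoid.Properties as ↭ₛ
open import Data.List.Relation.Unary.All as All using (All; []; _∷_)
import Data.List.Relation.Unary.All.Properties as All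
open import Data.List.Relation.Unary.AllPairs as AllPairs using ([]; _∷_)
open import Data.List.Relation.Unary.Any as Any using (Any; here; there; any?)
open import Data.List.Relation.Unary.Unique.Propositional using (Unique)
import Data.List.Relation.Unary.Unique.Propositional.Properties as Unique
open import Data.Nat.Base as ℕ using (ℕ; zero; suc; s≤s; z≤n)
import Data.Nat.Divisibility as ℕ
open import Data.Nat.DivMod using (_mod_; _%_; m<n⇒m%n≡m; n%n≡0; [m+n]%n≡m%n)
import Data.Nat.Tactic.RingSolver as ℕ
open import Data.Product using (∃-syntax; _×_; _,_; proj₁; proj₂)
open import Data.Sum as Sum using (inj₁; inj₂) renaming (_⊎_ to _or_)
open import Data.Unit using (⊤; tt)
open import Data.Vec.Base as Vec
  using (Vec; []; _∷_; toList; fromList; lookup; removeAt; tabulate; foldr₁)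
import Data.Vec.Properties as Vec
open import Relation.Binary.PropositionalEquality
open import Relation.Nullary using (¬_; Dec; yes; no; does; contradiction; ¬?)
open import Relation.Nullary.Decidable using (dec-true; dec-false; from-no; from-yes; _→-dec_)

-- Two obstacles shape the proof. A component that has been opened and partly taken is no endgame,
-- and play may move to the rest at any time. So the bound on all replies is proved for arbitrary
-- lists of lines with a property that survives the deletion of a line, next to a rest in which no
-- move claims a box; what counts is only how many boxes outside the rest are still there when a
-- line is drawn without a claim. The two bounds are also of unequal strength: both replies are
-- shown to be available after any opening line, but that nothing beats them is shown for a single
-- line, because the player who opens may choose it. The other obstacle is that moves never renumber
-- boxes, while `G ∖chain n∈` lives over a different set of boxes. Components are therefore paths of
-- boxes inside a given `Fin n`, a loop being a path cut at one box, and the value is shown to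
-- depend on the shapes alone. This comes from the recursion for the value itself, without a
-- bijection of boxes.

private variable
  n m m′ : ℕ

-- The order of the lines does not affect the value

∪-swap : (p q r : Subset n) → p ∪ (q ∪ r) ≡ q ∪ (p ∪ r)
∪-swap p q r = trans (sym (Subset.∪-assoc p q r))
  (trans (cong (_∪ r) (Subset.∪-comm p q)) (Subset.∪-assoc q p r))

⋃-↭ : {Ls Ms : List (Subset n)} → Ls ↭ Ms → ⋃ Ls ≡ ⋃ Ms
⋃-↭ ↭.refl         = refl
⋃-↭ (↭.prep s σ)   = cong (s ∪_) (⋃-↭ σ)
⋃-↭ (↭.swap s t σ) = trans (cong (λ p → s ∪ (t ∪ p)) (⋃-↭ σ)) (∪-swap s t _)
⋃-↭ (↭.trans σ τ)  = trans (⋃-↭ σ) (⋃-↭ τ)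

unclaimed-toList : (G : Lines n m) → unclaimed G ≡ ⋃ (toList G)
unclaimed-toList []      = refl
unclaimed-toList (s ∷ G) = cong (s ∪_) (unclaimed-toList G)

removeAt-↭ : ∀ {A : Set} (xs : Vec A (suc m)) i →
  toList xs ↭ lookup xs i ∷ toList (removeAt xs i)
removeAt-↭ (x ∷ xs)          zero    = ↭-refl
removeAt-↭ (x ∷ xs@(_ ∷ _)) (suc i) =
  ↭-trans (↭.prep x (removeAt-↭ xs i)) (↭.swap x _ ↭-refl)

∈-lookup⁻ : ∀ {A : Set} {x} (xs : Vec A m) → x ∈ toList xs → ∃[ i ] lookup xs i ≡ x
∈-lookup⁻ (_ ∷ xs) (here refl)  = zero , refl
∈-lookup⁻ (_ ∷ xs) (there x∈xs) with ∈-lookup⁻ xs x∈xs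
... | i , refl = suc i , refl

foldr₁-⊓-≤ : (f : Fin (suc m) → ℤ) → ∀ i → foldr₁ _⊓_ (tabulate f) ≤ f i
foldr₁-⊓-≤ {zero}  f zero    = ℤ.≤-refl
foldr₁-⊓-≤ {suc m} f zero    = ℤ.i⊓j≤i _ _
foldr₁-⊓-≤ {suc m} f (suc i) = ℤ.≤-trans (ℤ.i⊓j≤j _ _) (foldr₁-⊓-≤ (λ j → f (suc j)) i)

foldr₁-⊓-attained : (f : Fin (suc m) → ℤ) → ∃[ i ] foldr₁ _⊓_ (tabulate f) ≡ f i
foldr₁-⊓-attained {zero}  f = zero , refl
foldr₁-⊓-attained {suc m} f with ℤ.⊓-sel (f zero) (foldr₁ _⊓_ (tabulate λ j → f (suc j)))
... | inj₁ eq = zero , eq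
... | inj₂ eq with foldr₁-⊓-attained (λ j → f (suc j))
...   | i , eq′ = suc i , trans eq eq′

value-≤ : ∀ (G : Lines n (suc m)) i →
  value G ≤ moveValue (card (claimedBy G i)) (value (removeAt G i))
value-≤ G = foldr₁-⊓-≤ _

value-attained : ∀ (G : Lines n (suc m)) → ∃[ i ]
  value G ≡ moveValue (card (claimedBy G i)) (value (removeAt G i))
value-attained G = foldr₁-⊓-attained _

removeAt-matching : ∀ {A : Set} (xs : Vec A (suc m)) {y ys} → toList xs ↭ y ∷ ys →
  ∃[ i ] lookup xs i ≡ y × toList (removeAt xs i) ↭ ys
removeAt-matching xs {y} σ with ∈-lookup⁻ xs (↭.∈-resp-↭ (↭-sym σ) (here refl))
... | i , refl = i , refl , ↭.drop-∷ (↭-trans (↭-sym (removeAt-↭ xs i)) σ)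

unclaimed-cong : (G : Lines n m) {Ls : List (Subset n)} → toList G ↭ Ls → unclaimed G ≡ ⋃ Ls
unclaimed-cong G σ = trans (unclaimed-toList G) (⋃-↭ σ)

-- An optimal move in `H` is copied in `G`. A move without a claim negates the values, so the
-- recursion exchanges the two positions; this is why a single inequality, for all pairs, is enough.
value-mono-↭ : (G : Lines n m) (H : Lines n m′) → toList G ↭ toList H → value G ≤ value H
value-mono-↭ {m = zero}  {zero}   G H σ = ℤ.≤-refl
value-mono-↭ {m = zero}  {suc m′} [] (_ ∷ _) σ = contradiction (↭-sym σ) ↭.¬x∷xs↭[]
value-mono-↭ {m = suc m} {zero}   (_ ∷ _) [] σ = contradiction σ ↭.¬x∷xs↭[]
value-mono-↭ {m = suc m} {suc m′} G H σ with value-attained H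
... | j , eq with removeAt-matching G (↭-trans σ (removeAt-↭ H j))
...   | i , _ , τ rewrite eq =
  ℤ.≤-trans (value-≤ G i)
    (subst (λ k → moveValue k (value (removeAt G i)) ≤ moveValue (card (claimedBy H j)) (value (removeAt H j)))
      (sym (cong card claimed≡)) (mono (card (claimedBy H j))))
  where
  claimed≡ : claimedBy G i ≡ claimedBy H j
  claimed≡ = cong₂ _─_ (trans (unclaimed-cong G σ) (sym (unclaimed-toList H)))
    (trans (unclaimed-cong (removeAt G i) τ) (sym (unclaimed-toList (removeAt H j))))
  mono : ∀ k → moveValue k (value (removeAt G i)) ≤ moveValue k (value (removeAt H j))
  mono zero    = ℤ.neg-mono-≤ (value-mono-↭ (removeAt H j) (removeAt G i) (↭-sym τ))
  mono (suc k) = ℤ.+-monoˡ-≤ (- + suc k) (value-mono-↭ (removeAt G i) (removeAt H j) τ)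

value-↭ : (G : Lines n m) (H : Lines n m′) → toList G ↭ toList H → value G ≡ value H
value-↭ G H σ = ℤ.≤-antisym (value-mono-↭ G H σ) (value-mono-↭ H G (↭-sym σ))

-- Boxes claimed by a move, and the normalised value

card-─ : (p q : Subset n) → q ⊆ p → card p ≡ card (p ─ q) ℕ.+ card q
card-─ []            []            q⊆p = refl
card-─ (outside ∷ p) (outside ∷ q) q⊆p = card-─ p q (Subset.drop-∷-⊆ q⊆p)
card-─ (outside ∷ p) (inside  ∷ q) q⊆p with q⊆p Vec.here
... | ()
card-─ (inside  ∷ p) (outside ∷ q) q⊆p = cong suc (card-─ p q (Subset.drop-∷-⊆ q⊆p))
card-─ (inside  ∷ p) (inside  ∷ q) q⊆p =
  trans (cong suc (card-─ p q (Subset.drop-∷-⊆ q⊆p))) (sym (ℕ.+-suc (card (p ─ q)) _))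

card-─-≡0 : (p q : Subset n) → card (p ─ q) ≡ 0 → p ⊆ q
card-─-≡0 p q eq {x} x∈p with x Subset.∈? q
... | yes x∈q = x∈q
... | no  x∉q = contradiction (ℕ.≤-trans (ℕ.≤-reflexive (sym (Subset.∣⁅x⁆∣≡1 x)))
        (ℕ.≤-trans (Subset.p⊆q⇒∣p∣≤∣q∣ {p = ⁅ x ⁆} {q = p ─ q}
          λ {y} y∈ → subst (_∈ˢ (p ─ q)) (sym (Subset.x∈⁅y⁆⇒x≡y x y∈)) (Subset.x∈p∧x∉q⇒x∈p─q x∈p x∉q))
        (ℕ.≤-reflexive eq))) λ ()

total : List (Subset n) → ℤ
total Ls = + card (⋃ Ls)

-- Twice the number of boxes that the player not to move gets from the lines Ls.
-- In this normalisation a move claiming boxes leaves the value unchanged.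
opaque
  ζ : List (Subset n) → ℤ
  ζ Ls = total Ls + value (fromList Ls)

  ζ-unfold : (Ls : List (Subset n)) → ζ Ls ≡ total Ls + value (fromList Ls)
  ζ-unfold Ls = refl

fromList-toList-value : (G : Lines n m) → value (fromList (toList G)) ≡ value G
fromList-toList-value G =
  value-↭ (fromList (toList G)) G (↭-reflexive (Vec.toList∘fromList (toList G)))

ζ-↭ : {Ls Ms : List (Subset n)} → Ls ↭ Ms → ζ Ls ≡ ζ Ms
ζ-↭ {Ls = Ls} {Ms} σ rewrite ζ-unfold Ls | ζ-unfold Ms = cong₂ _+_ (cong (λ p → + card p) (⋃-↭ σ))
  (value-↭ (fromList Ls) (fromList Ms)
    (subst₂ _↭_ (sym (Vec.toList∘fromList Ls)) (sym (Vec.toList∘fromList Ms)) σ))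

module _ (s : Subset n) (Ls : List (Subset n)) where

  moved : ℕ → ℤ
  moved k = total (s ∷ Ls) + moveValue k (value (fromList Ls))

  claimed : Subset n
  claimed = ⋃ (s ∷ Ls) ─ ⋃ Ls

  total-claimed : total (s ∷ Ls) ≡ + card claimed + total Ls
  total-claimed = cong +_ (card-─ (⋃ (s ∷ Ls)) (⋃ Ls) (Subset.q⊆p∪q s (⋃ Ls)))

  absorbed : s ⊆ ⋃ Ls → ⋃ (s ∷ Ls) ≡ ⋃ Ls
  absorbed s⊆ = Subset.⊆-antisym
    (λ x∈ → Sum.[ s⊆ , (λ y → y) ] (Subset.x∈p∪q⁻ s (⋃ Ls) x∈)) (Subset.q⊆p∪q s (⋃ Ls))

  claimed-⊆ : s ⊆ ⋃ Ls → card claimed ≡ 0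
  claimed-⊆ s⊆ = ℕ.+-cancelʳ-≡ (card (⋃ Ls)) _ 0
    (trans (sym (card-─ (⋃ (s ∷ Ls)) (⋃ Ls) (Subset.q⊆p∪q s (⋃ Ls)))) (cong card (absorbed s⊆)))

  moved-pass : s ⊆ ⋃ Ls → moved (card claimed) ≡ total Ls + total Ls - ζ Ls
  moved-pass s⊆ rewrite ζ-unfold Ls | claimed-⊆ s⊆ | absorbed s⊆ = lemma (total Ls) (value (fromList Ls))
    where
    lemma : ∀ t w → t + - w ≡ t + t - (t + w)
    lemma = solve-∀

  moved-claim : s ⊈ ⋃ Ls → moved (card claimed) ≡ ζ Ls
  moved-claim s⊈ = trans (cong (_+ moveValue (card claimed) w) total-claimed) (go (card claimed) refl)
    where
    w = value (fromList Ls)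
    lemma : ∀ k t w → k + t + (w - k) ≡ t + w
    lemma = solve-∀
    go : ∀ k → card claimed ≡ k → + k + total Ls + moveValue k w ≡ ζ Ls
    go zero    eq = contradiction
      (λ {x} x∈s → card-─-≡0 (⋃ (s ∷ Ls)) (⋃ Ls) eq (Subset.p⊆p∪q (⋃ Ls) x∈s)) s⊈
    go (suc k) eq = trans (lemma (+ suc k) (total Ls) w) (sym (ζ-unfold Ls))

  moved-≤ : ζ (s ∷ Ls) ≤ moved (card claimed)
  moved-≤ rewrite ζ-unfold (s ∷ Ls) = ℤ.+-monoʳ-≤ (total (s ∷ Ls))
    (subst (λ p → value (fromList (s ∷ Ls)) ≤ moveValue (card p) (value (fromList Ls)))
      (cong₂ _─_ (unclaimed-cong (fromList (s ∷ Ls)) (↭-reflexive (Vec.toList∘fromList (s ∷ Ls))))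
                 (unclaimed-cong (fromList Ls) (↭-reflexive (Vec.toList∘fromList Ls))))
      (value-≤ (fromList (s ∷ Ls)) zero))

  ζ-claim : s ⊈ ⋃ Ls → ζ (s ∷ Ls) ≤ ζ Ls
  ζ-claim s⊈ = ℤ.≤-trans moved-≤ (ℤ.≤-reflexive (moved-claim s⊈))

  ζ-pass : s ⊆ ⋃ Ls → ζ (s ∷ Ls) ≤ total Ls + total Ls - ζ Ls
  ζ-pass s⊆ = ℤ.≤-trans moved-≤ (ℤ.≤-reflexive (moved-pass s⊆))

-- From here on the rules of play enter only through this dichotomy, which says where the minimum is
-- attained, and through the bounds `ζ-claim` and `ζ-pass`, which hold for every move.
data BestMove (Ls : List (Subset n)) : Set where
  claim : ∀ s Ms → Ls ↭ s ∷ Ms → s ⊈ ⋃ Ms → ζ Ls ≡ ζ Ms → BestMove Ls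
  pass  : ∀ s Ms → Ls ↭ s ∷ Ms → s ⊆ ⋃ Ms → ζ Ls ≡ total Ms + total Ms - ζ Ms → BestMove Ls

bestMove : (s : Subset n) (Ls : List (Subset n)) → BestMove (s ∷ Ls)
bestMove {n} s₀ Ls₀ with value-attained (fromList (s₀ ∷ Ls₀))
... | i , eq = go
  where
  G = fromList (s₀ ∷ Ls₀)
  s = lookup G i
  Ms = toList (removeAt G i)
  toList-G : toList G ↭ s₀ ∷ Ls₀
  toList-G = ↭-reflexive (Vec.toList∘fromList (s₀ ∷ Ls₀))
  σ : s₀ ∷ Ls₀ ↭ s ∷ Ms
  σ = ↭-trans (↭-sym toList-G) (removeAt-↭ G i)
  ζ≡ : ζ (s₀ ∷ Ls₀) ≡ moved s Ms (card (claimed s Ms))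
  ζ≡ = trans (ζ-unfold (s₀ ∷ Ls₀)) (cong₂ _+_ (cong (λ p → + card p) (⋃-↭ σ))
    (trans eq (cong₂ moveValue
      (cong card (cong₂ _─_ (unclaimed-cong G (removeAt-↭ G i)) (unclaimed-toList (removeAt G i))))
      (sym (fromList-toList-value (removeAt G i))))))
  go : BestMove (s₀ ∷ Ls₀)
  go with s Subset.⊆? ⋃ Ms
  ... | yes s⊆ = pass s Ms σ s⊆ (trans ζ≡ (moved-pass s Ms s⊆))
  ... | no  s⊈ = claim s Ms σ s⊈ (trans ζ≡ (moved-claim s Ms s⊈))

-- Reduces a linear inequality to a ring identity: its slack is exhibited as the slack of a known
-- inequality, and the solver checks that the two agree.
≤-by-difference : ∀ {i j k l} → i ≤ j → l - k ≡ j - i → k ≤ l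
≤-by-difference i≤j eq =
  ℤ.0≤i-j⇒j≤i (subst (+ 0 ≤_) (sym eq) (ℤ.i≤j⇒0≤j-i i≤j))

i+j≤k⇒i≤k-j : ∀ {i j k} → i + j ≤ k → i ≤ k - j
i+j≤k⇒i≤k-j {i} {j} {k} le = ≤-by-difference le (lemma i j k)
  where
  lemma : ∀ i j k → k - j - i ≡ k - (i + j)
  lemma = solve-∀

-- Lines that can be taken in succession

total-↭ : {Ls Ms : List (Subset n)} → Ls ↭ Ms → total Ls ≡ total Ms
total-↭ σ = cong (λ p → + card p) (⋃-↭ σ)

∈⇒↭ : ∀ {A : Set} {x : A} {xs} → x ∈ xs → ∃[ ys ] xs ↭ x ∷ ys
∈⇒↭ x∈xs with Mem.∈-∃++ x∈xs
... | ys , zs , refl = ys ++ zs , ↭.shift _ ys zs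

⊆-respʳ : {s p q : Subset n} → p ≡ q → s ⊆ p → s ⊆ q
⊆-respʳ refl s⊆p = s⊆p

∪-least : ∀ {p q r : Subset n} → p ⊆ r → q ⊆ r → p ∪ q ⊆ r
∪-least {p = p} {q} p⊆r q⊆r x∈ with Subset.x∈p∪q⁻ p q x∈
... | inj₁ x∈p = p⊆r x∈p
... | inj₂ x∈q = q⊆r x∈q

⋃-++ : (Ls Ms : List (Subset n)) → ⋃ (Ls ++ Ms) ≡ ⋃ Ls ∪ ⋃ Ms
⋃-++ []       Ms = sym (Subset.∪-identityˡ _)
⋃-++ (s ∷ Ls) Ms = trans (cong (s ∪_) (⋃-++ Ls Ms)) (sym (Subset.∪-assoc s _ _))

⋃-++ˡ : (Ls Ms : List (Subset n)) → ⋃ Ls ⊆ ⋃ (Ls ++ Ms)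
⋃-++ˡ Ls Ms rewrite ⋃-++ Ls Ms = Subset.p⊆p∪q _

⋃-++ʳ : (Ls Ms : List (Subset n)) → ⋃ Ms ⊆ ⋃ (Ls ++ Ms)
⋃-++ʳ Ls Ms rewrite ⋃-++ Ls Ms = Subset.q⊆p∪q _ _

⋃-++-mono : ∀ Ks {Ls Ms : List (Subset n)} → ⋃ Ls ⊆ ⋃ Ms → ⋃ (Ks ++ Ls) ⊆ ⋃ (Ks ++ Ms)
⋃-++-mono Ks {Ls} {Ms} sub rewrite ⋃-++ Ks Ls | ⋃-++ Ks Ms =
  ∪-least (Subset.p⊆p∪q _) (λ x∈ → Subset.q⊆p∪q _ _ (sub x∈))

⊈-mono : {s p q : Subset n} → q ⊆ p → s ⊈ p → s ⊈ q
⊈-mono q⊆p s⊈p s⊆q = s⊈p (λ x∈s → q⊆p (s⊆q x∈s))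

delete-↭ : ∀ {A : Set} (as : List A) {s bs Ls} → (as ++ s ∷ bs) ++ Ls ↭ s ∷ (as ++ bs) ++ Ls
delete-↭ as {s} {bs} {Ls} = ↭.++⁺ʳ Ls (↭.shift s as bs)

⋃-delete : (as : List (Subset n)) {s : Subset n} {bs Ls : List (Subset n)} →
  ⋃ ((as ++ bs) ++ Ls) ⊆ ⋃ ((as ++ s ∷ bs) ++ Ls)
⋃-delete as {s} {bs} {Ls} rewrite ⋃-↭ (delete-↭ as {s} {bs} {Ls}) = Subset.q⊆p∪q _ _

-- Drawn in the given order, each line claims a box.
data Takeable (R : List (Subset n)) : List (Subset n) → Set where
  []  : Takeable R []
  _∷_ : ∀ {s ss} → s ⊈ ⋃ (ss ++ R) → Takeable R ss → Takeable R (s ∷ ss)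

Takeable-mono : {R S ss : List (Subset n)} → ⋃ S ⊆ ⋃ R → Takeable R ss → Takeable S ss
Takeable-mono S⊆R []                   = []
Takeable-mono {ss = s ∷ ss} S⊆R (s⊈ ∷ t) =
  ⊈-mono {s = s} (⋃-++-mono ss S⊆R) s⊈ ∷ Takeable-mono S⊆R t

-- With one line fewer left over, an earlier line that claimed a box still claims it.
Takeable-delete : {R : List (Subset n)} (as : List (Subset n)) {s : Subset n} {bs : List (Subset n)} →
  Takeable R (as ++ s ∷ bs) → Takeable R (as ++ bs)
Takeable-delete []       (_ ∷ t)  = t
Takeable-delete (a ∷ as) (a⊈ ∷ t) = ⊈-mono {s = a} (⋃-delete as) a⊈ ∷ Takeable-delete as t

ζ-take : {R ss : List (Subset n)} → Takeable R ss → ζ (ss ++ R) ≤ ζ R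
ζ-take []       = ℤ.≤-refl
ζ-take {R = R} (_∷_ {ss = ss} s⊈ t) = ℤ.≤-trans (ζ-claim _ (ss ++ R) s⊈) (ζ-take t)

card-⊈ : {s p : Subset n} → s ⊈ p → card p ℕ.< card (s ∪ p)
card-⊈ {s = s} {p} s⊈p with card (s ∪ p ─ p) in eq
... | zero  = contradiction (λ {x} x∈s → card-─-≡0 (s ∪ p) p eq (Subset.p⊆p∪q p x∈s)) s⊈p
... | suc k = ℕ.≤-trans (s≤s (ℕ.m≤n+m _ k))
  (ℕ.≤-reflexive (sym (trans (card-─ (s ∪ p) p (Subset.q⊆p∪q s p)) (cong (ℕ._+ card p) eq))))

Takeable-card : {R ss : List (Subset n)} → Takeable R ss →
  length ss ℕ.+ card (⋃ R) ℕ.≤ card (⋃ (ss ++ R))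
Takeable-card []       = ℕ.≤-refl
Takeable-card (s⊈ ∷ t) = ℕ.≤-trans (s≤s (Takeable-card t)) (card-⊈ s⊈)

-- The line drawn last has only `R` beside it and claims at least two boxes; every earlier one
-- claims at least one. This makes one box more than there are lines.
Takeable-card⁺ : ∀ {R : List (Subset n)} {s ss} → Takeable R (s ∷ ss) →
  All (λ s → 2 ℕ.+ card (⋃ R) ℕ.≤ card (s ∪ ⋃ R)) (s ∷ ss) →
  2 ℕ.+ length ss ℕ.+ card (⋃ R) ℕ.≤ card (⋃ ((s ∷ ss) ++ R))
Takeable-card⁺ {ss = []}    t        (two ∷ _)  = two
Takeable-card⁺ {ss = _ ∷ _} (s⊈ ∷ t) (_ ∷ twos) =
  ℕ.≤-trans (s≤s (Takeable-card⁺ t twos)) (card-⊈ s⊈)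

-- Drawn in the reverse order, each line claims a box; W contains the boxes of the lines further left.
BackTakeable : Subset n → List (Subset n) → Set
BackTakeable W []       = ⊤
BackTakeable W (s ∷ ss) = s ⊈ W × BackTakeable (s ∪ W) ss

BackTakeable-mono : ∀ {V W : Subset n} ss → V ⊆ W → BackTakeable W ss → BackTakeable V ss
BackTakeable-mono []       V⊆W _        = tt
BackTakeable-mono (s ∷ ss) V⊆W (s⊈ , b) = ⊈-mono {s = s} V⊆W s⊈ ,
  BackTakeable-mono ss (∪-least (Subset.p⊆p∪q _) (λ x∈ → Subset.q⊆p∪q s _ (V⊆W x∈))) b

BackTakeable-delete : ∀ {W : Subset n} as {s bs} →
  BackTakeable W (as ++ s ∷ bs) → BackTakeable W (as ++ bs)
BackTakeable-delete []       {bs = bs} (_ , b) = BackTakeable-mono bs (Subset.q⊆p∪q _ _) b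
BackTakeable-delete (a ∷ as) (a⊈ , b)          = a⊈ , BackTakeable-delete as b

BackTakeable-last : ∀ {W : Subset n} as {s} → BackTakeable W (as ++ s ∷ []) → s ⊈ ⋃ as ∪ W
BackTakeable-last {W = W} []       (s⊈ , _) rewrite Subset.∪-identityˡ W = s⊈
BackTakeable-last {W = W} (a ∷ as) (_ , b)
  rewrite Subset.∪-assoc a (⋃ as) W | ∪-swap a (⋃ as) W = BackTakeable-last as b

TwoWay : List (Subset n) → List (Subset n) → Set
TwoWay R ss = Takeable R ss × BackTakeable (⋃ R) ss

TwoWay-delete : ∀ {R : List (Subset n)} as {s bs} → TwoWay R (as ++ s ∷ bs) → TwoWay R (as ++ bs)
TwoWay-delete as (t , b) = Takeable-delete as t , BackTakeable-delete as b

-- A line that claims nothing cannot be the first, which claims a box in the forward order, nor the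
-- last, which claims one in the reverse order.
TwoWay-pass : ∀ {R : List (Subset n)} as {s bs} → TwoWay R (as ++ s ∷ bs) →
  s ⊆ ⋃ ((as ++ bs) ++ R) → 3 ℕ.≤ length (as ++ s ∷ bs)
TwoWay-pass []       (s⊈ ∷ _ , _) s⊆ = ⊥-elim (s⊈ s⊆)
TwoWay-pass {R = R} as@(_ ∷ _) {s} {[]} (_ , b) s⊆ =
  ⊥-elim (BackTakeable-last as b
    (⊆-respʳ (trans (cong (λ Ls → ⋃ (Ls ++ R)) (List.++-identityʳ as)) (⋃-++ as R)) s⊆))
TwoWay-pass (_ ∷ as) {s} {t ∷ bs} _ _ = s≤s (ℕ.≤-trans (s≤s (s≤s z≤n))
  (ℕ.≤-trans (ℕ.m≤n+m _ (length as)) (ℕ.≤-reflexive (sym (List.length-++ as)))))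

-- Lower bounds next to a rest without captures

Quiet : List (Subset n) → Set
Quiet R = ∀ {s Ms} → R ↭ s ∷ Ms → s ⊆ ⋃ Ms

module _ {n : ℕ} (R : List (Subset n)) (quiet : Quiet R) where

  -- A line of R never claims a box, and opening R before all of ss has been taken
  -- is no better than taking ss first.
  ζ-lower : ∀ η → η ≤ ζ R → (Inv : List (Subset n) → Set) →
    (∀ {ss} → Inv ss → Takeable R ss) →
    (∀ as {s bs} → Inv (as ++ s ∷ bs) → Inv (as ++ bs)) →
    (∀ as {s bs} → Inv (as ++ s ∷ bs) → s ⊆ ⋃ ((as ++ bs) ++ R) →
       η + ζ R ≤ total ((as ++ bs) ++ R) + total ((as ++ bs) ++ R)) →
    ∀ ss → Inv ss → η ≤ ζ (ss ++ R)
  ζ-lower η η≤ Inv takeable delete passing ss inv = go (length ss) ss refl inv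
    where
    go : ∀ k ss → length ss ≡ k → Inv ss → η ≤ ζ (ss ++ R)
    move : ∀ k ss → length ss ≡ suc k → Inv ss → BestMove (ss ++ R) → η ≤ ζ (ss ++ R)
    go zero    []       _  _   = η≤
    go (suc k) (s ∷ ss) eq inv = move k (s ∷ ss) eq inv (bestMove s (ss ++ R))

    inR : ∀ {ss t Ms} → t ∈ R → ss ++ R ↭ t ∷ Ms →
      ∃[ R′ ] R ↭ t ∷ R′ × t ⊆ ⋃ R′ × Ms ↭ ss ++ R′
    inR {ss} {t} t∈R σ with ∈⇒↭ t∈R
    ... | R′ , ρ = R′ , ρ , quiet ρ , ↭.drop-∷ (↭-trans (↭-sym σ)
      (↭-trans (↭.++⁺ˡ ss ρ) (↭.shift t ss R′)))

    split : ∀ {k ss t} → t ∈ ss → length ss ≡ suc k →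
      ∃[ as ] ∃[ bs ] ss ≡ as ++ t ∷ bs × length (as ++ bs) ≡ k
    split t∈ss eq with Mem.∈-∃++ t∈ss
    ... | as , bs , refl = as , bs , refl , ℕ.suc-injective (trans (sym (↭.↭-length (↭.shift _ as bs))) eq)

    move k ss eq inv (claim t Ms σ t⊈ ζ≡) with Mem.∈-++⁻ ss (↭.∈-resp-↭ (↭-sym σ) (here refl))
    ... | inj₂ t∈R with inR {ss} t∈R σ
    ...   | R′ , ρ , t⊆ , τ =
      ⊥-elim (t⊈ (λ x∈ → ⊆-respʳ (sym (⋃-↭ τ)) (⋃-++ʳ ss R′) (t⊆ x∈)))
    move k ss eq inv (claim t Ms σ t⊈ ζ≡) | inj₁ t∈ss with split t∈ss eq
    ... | as , bs , refl , eq′ = ℤ.≤-trans (go k (as ++ bs) eq′ (delete as inv))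
      (ℤ.≤-reflexive (sym (trans ζ≡ (ζ-↭ (↭.drop-∷ (↭-trans (↭-sym σ) (delete-↭ as)))))))
    move k ss eq inv (pass t Ms σ t⊆ ζ≡) with Mem.∈-++⁻ ss (↭.∈-resp-↭ (↭-sym σ) (here refl))
    ... | inj₁ t∈ss with split t∈ss eq
    ...   | as , bs , refl , eq′ = subst (η ≤_) (sym ζ≡)
      (i+j≤k⇒i≤k-j (ℤ.≤-trans
        (ℤ.+-monoʳ-≤ η (ℤ.≤-trans (ℤ.≤-reflexive (ζ-↭ τ)) (ζ-take (takeable (delete as inv)))))
        (ℤ.≤-trans (passing as inv (⊆-respʳ (⋃-↭ τ) t⊆))
          (ℤ.≤-reflexive (sym (cong₂ _+_ (total-↭ τ) (total-↭ τ)))))))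
      where
      τ : Ms ↭ (as ++ bs) ++ R
      τ = ↭.drop-∷ (↭-trans (↭-sym σ) (delete-↭ as))
    move k ss eq inv (pass t Ms σ t⊆ ζ≡) | inj₂ t∈R with inR {ss} t∈R σ
    -- Compare with drawing `t` after `ss` has gone, which bounds `ζ R` from above. With `ss` still
    -- there the total is no smaller, and `ζ Ms` is no larger because the opponent may take `ss`
    -- first.
    ... | R′ , ρ , t⊆R′ , τ = subst (η ≤_) (sym ζ≡)
      (≤-by-difference
        (ℤ.+-mono-≤ (ℤ.+-mono-≤ (ℤ.≤-trans η≤ (ℤ.≤-trans (ℤ.≤-reflexive (ζ-↭ ρ)) (ζ-pass t R′ t⊆R′))) ζMs≤)
                    (ℤ.+-mono-≤ t≤ t≤))
        (lemma η (ζ Ms) (ζ R′) (total Ms) (total R′)))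
      where
      ζMs≤ : ζ Ms ≤ ζ R′
      ζMs≤ = ℤ.≤-trans (ℤ.≤-reflexive (ζ-↭ τ))
        (ζ-take (Takeable-mono (⊆-respʳ (sym (⋃-↭ ρ)) (Subset.q⊆p∪q t (⋃ R′))) (takeable inv)))
      t≤ : total R′ ≤ total Ms
      t≤ = +≤+ (Subset.p⊆q⇒∣p∣≤∣q∣ (⊆-respʳ (sym (⋃-↭ τ)) (⋃-++ʳ ss R′)))
      lemma : ∀ η z z′ t t′ → t + t - z - η ≡ t′ + t′ - z′ + z′ + (t + t) - (η + z + (t′ + t′))
      lemma = solve-∀

  -- Each of at most two such lines claims a box whenever it is drawn, so there is nothing to decline.
  ζ-lower-matching : ∀ ss → TwoWay R ss → length ss ℕ.≤ 2 → ζ R ≤ ζ (ss ++ R)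
  ζ-lower-matching ss tw short =
    ζ-lower (ζ R) ℤ.≤-refl (λ ss → TwoWay R ss × length ss ℕ.≤ 2) (λ i → proj₁ (proj₁ i))
      (λ as {s} {bs} i → TwoWay-delete as (proj₁ i) , ℕ.≤-trans (ℕ.n≤1+n _)
        (ℕ.≤-trans (ℕ.≤-reflexive (sym (↭.↭-length (↭.shift s as bs)))) (proj₂ i)))
      (λ as i s⊆ → contradiction (ℕ.≤-trans (TwoWay-pass as (proj₁ i) s⊆) (proj₂ i)) λ { (s≤s (s≤s ())) })
      ss (tw , short)

  -- Drawing e gives away the boxes of ss but makes the opponent move first in R.
  ζ-control : ∀ e ss → e ⊆ ⋃ (ss ++ R) → TwoWay R ss → length ss ℕ.≤ 2 →
    ζ (e ∷ ss ++ R) ≤ total (ss ++ R) + total (ss ++ R) - ζ R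
  ζ-control e ss e⊆ tw short = ℤ.≤-trans (ζ-pass e (ss ++ R) e⊆)
    (ℤ.+-monoʳ-≤ (total (ss ++ R) + total (ss ++ R)) (ℤ.neg-mono-≤ (ζ-lower-matching ss tw short)))

  private
    pass-total : ∀ as {s : Subset n} {bs} → s ⊆ ⋃ ((as ++ bs) ++ R) →
      total ((as ++ s ∷ bs) ++ R) ≡ total ((as ++ bs) ++ R)
    pass-total as {s} {bs} s⊆ = cong (λ p → + card p) (trans (⋃-↭ (delete-↭ as {s} {bs})) (absorbed s ((as ++ bs) ++ R) s⊆))

    doubled : ∀ h {k ss} {η} → h ℕ.≤ k → k ℕ.+ card (⋃ R) ℕ.≤ card (⋃ (ss ++ R)) →
      η ≤ total R + total R + (+ h + + h) - ζ R →
      η + ζ R ≤ total (ss ++ R) + total (ss ++ R)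
    doubled h {k} {ss} {η} h≤k k≤ η≤ = ≤-by-difference (ℤ.+-mono-≤ η≤ (ℤ.+-mono-≤ t≤ t≤))
      (lemma η (+ h) (total R) (total (ss ++ R)) (ζ R))
      where
      t≤ : + h + total R ≤ total (ss ++ R)
      t≤ = +≤+ (ℕ.≤-trans (ℕ.+-monoˡ-≤ (card (⋃ R)) h≤k) k≤)
      lemma : ∀ η h t T z → T + T - (η + z) ≡ (t + t + (h + h) - z) + (T + T) - (η + (h + t + (h + t)))
      lemma = solve-∀

  -- The `+ 4` is twice the two boxes that a pass must leave: a single takeable line would claim a
  -- box, so a pass finds at least two lines, and each of them is good for a box.
  ζ-lower-chain : ∀ ss η → Takeable R ss → η ≤ ζ R → η ≤ total R + total R + + 4 - ζ R →
    η ≤ ζ (ss ++ R)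
  ζ-lower-chain ss η t η≤ η≤′ = ζ-lower η η≤ (Takeable R) (λ t → t) Takeable-delete passing ss t
    where
    passing : ∀ as {s bs} → Takeable R (as ++ s ∷ bs) → s ⊆ ⋃ ((as ++ bs) ++ R) →
       η + ζ R ≤ total ((as ++ bs) ++ R) + total ((as ++ bs) ++ R)
    passing as {s} {bs} t s⊆ = subst (λ x → η + ζ R ≤ x + x) (pass-total as s⊆)
      (doubled 2 {ss = as ++ s ∷ bs} (2≤ as t s⊆) (Takeable-card t) η≤′)
      where
      2≤ : ∀ as {s bs} → Takeable R (as ++ s ∷ bs) → s ⊆ ⋃ ((as ++ bs) ++ R) → 2 ℕ.≤ length (as ++ s ∷ bs)
      2≤ []       {bs = []}    (s⊈ ∷ _) s⊆ = ⊥-elim (s⊈ s⊆)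
      2≤ []       {bs = _ ∷ _} _        s⊆ = s≤s (s≤s z≤n)
      2≤ (_ ∷ as) {s} {bs}     _        _  = s≤s (ℕ.≤-trans (s≤s z≤n)
        (ℕ.≤-reflexive (sym (↭.↭-length (↭.shift s as bs)))))

  -- The `+ 8` is twice four boxes. By `TwoWay-pass` a pass finds at least three lines, and these
  -- hold four boxes because the last one to be drawn claims two.
  ζ-lower-loop : ∀ ss η → TwoWay R ss → All (λ s → 2 ℕ.+ card (⋃ R) ℕ.≤ card (s ∪ ⋃ R)) ss →
    η ≤ ζ R → η ≤ total R + total R + + 8 - ζ R → η ≤ ζ (ss ++ R)
  ζ-lower-loop ss η tw twos η≤ η≤′ = ζ-lower η η≤ Inv (λ i → proj₁ (proj₁ i))
    (λ as i → TwoWay-delete as (proj₁ i) , deleteAll as (proj₂ i)) passing ss (tw , twos)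
    where
    Inv : List (Subset n) → Set
    Inv ss = TwoWay R ss × All (λ s → 2 ℕ.+ card (⋃ R) ℕ.≤ card (s ∪ ⋃ R)) ss
    deleteAll : ∀ {P : Subset n → Set} as {s bs} → All P (as ++ s ∷ bs) → All P (as ++ bs)
    deleteAll as all with All.++⁻ as all
    ... | pas , _ ∷ pbs = All.++⁺ pas pbs
    passing : ∀ as {s bs} → Inv (as ++ s ∷ bs) → s ⊆ ⋃ ((as ++ bs) ++ R) →
       η + ζ R ≤ total ((as ++ bs) ++ R) + total ((as ++ bs) ++ R)
    passing as {s} {bs} (tw , twos) s⊆ = subst (λ x → η + ζ R ≤ x + x) (pass-total as s⊆)
      (doubled 4 {1 ℕ.+ length (as ++ s ∷ bs)} {as ++ s ∷ bs} (s≤s three)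
        (card⁺ (as ++ s ∷ bs) three tw twos) η≤′)
      where
      three : 3 ℕ.≤ length (as ++ s ∷ bs)
      three = TwoWay-pass as tw s⊆
      card⁺ : ∀ ss → 3 ℕ.≤ length ss → TwoWay R ss → All (λ s → 2 ℕ.+ card (⋃ R) ℕ.≤ card (s ∪ ⋃ R)) ss →
        1 ℕ.+ length ss ℕ.+ card (⋃ R) ℕ.≤ card (⋃ (ss ++ R))
      card⁺ (s ∷ ss) _ (t , _) twos = Takeable-card⁺ t twos

-- Paths of boxes

-- The lines of a path running from y through the boxes bs to z are
-- edge y z bs ∷ half z bs; so half z bs are the lines left after the first has
-- been drawn. An end y or z is ⊥ where the path reaches the ground.
edge : Subset n → Subset n → List (Fin n) → Subset n
edge y z []      = y ∪ z
edge y z (b ∷ _) = y ∪ ⁅ b ⁆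

half : Subset n → List (Fin n) → List (Subset n)
half z []       = []
half z (b ∷ bs) = edge ⁅ b ⁆ z bs ∷ half z bs

y⊆edge : ∀ {y z : Subset n} bs → y ⊆ edge y z bs
y⊆edge []      = Subset.p⊆p∪q _
y⊆edge (b ∷ _) = Subset.p⊆p∪q _

∈-⋃-half : ∀ {z : Subset n} bs Ls {x} → x ∈ˢ ⋃ (half z bs ++ Ls) →
  x ∈ bs or (x ∈ˢ z ∪ ⋃ Ls)
∈-⋃-half {z = z} []       Ls x∈ = inj₂ (Subset.q⊆p∪q z _ x∈)
∈-⋃-half {z = z} (b ∷ bs) Ls x∈ with Subset.x∈p∪q⁻ (edge ⁅ b ⁆ z bs) _ x∈
... | inj₂ x∈half with ∈-⋃-half bs Ls x∈half
...   | inj₁ x∈bs = inj₁ (there x∈bs)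
...   | inj₂ x∈zL = inj₂ x∈zL
∈-⋃-half {z = z} (b ∷ bs) Ls x∈ | inj₁ x∈edge = onEdge bs x∈edge
  where
  onEdge : ∀ bs {x} → x ∈ˢ edge ⁅ b ⁆ z bs → x ∈ b ∷ bs or (x ∈ˢ z ∪ ⋃ Ls)
  onEdge [] x∈ with Subset.x∈p∪q⁻ ⁅ b ⁆ z x∈
  ... | inj₁ x∈b = inj₁ (here (Subset.x∈⁅y⁆⇒x≡y b x∈b))
  ... | inj₂ x∈z = inj₂ (Subset.p⊆p∪q (⋃ Ls) x∈z)
  onEdge (c ∷ _) x∈ with Subset.x∈p∪q⁻ ⁅ b ⁆ ⁅ c ⁆ x∈
  ... | inj₁ x∈b = inj₁ (here (Subset.x∈⁅y⁆⇒x≡y b x∈b))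
  ... | inj₂ x∈c = inj₁ (there (here (Subset.x∈⁅y⁆⇒x≡y c x∈c)))

Free : Subset n → List (Fin n) → Set
Free W bs = Unique bs × (∀ {b} → b ∈ bs → b ∉ W)

Free-tail : ∀ {W : Subset n} {b bs} → Free W (b ∷ bs) → Free W bs
Free-tail (u , ∉W) = AllPairs.tail u , λ b∈ → ∉W (there b∈)

Free-++ʳ : ∀ {W : Subset n} as {bs} → Free W (as ++ bs) → Free W bs
Free-++ʳ []       free = free
Free-++ʳ (a ∷ as) free = Free-++ʳ as (Free-tail free)

Free-↭ : ∀ {W : Subset n} {as bs} → as ↭ bs → Free W as → Free W bs
Free-↭ σ (u , ∉W) = ↭ₛ.Unique-resp-↭ (setoid _) (↭.↭⇒↭ₛ σ) u
  , λ b∈ → ∉W (↭.∈-resp-↭ (↭-sym σ) b∈)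

∉-∪ : ∀ {p q : Subset n} {x} → x ∉ p → x ∉ q → x ∉ p ∪ q
∉-∪ {p = p} {q} x∉p x∉q x∈ with Subset.x∈p∪q⁻ p q x∈
... | inj₁ x∈p = x∉p x∈p
... | inj₂ x∈q = x∉q x∈q

∈⇒⊈ : ∀ {p q : Subset n} x → x ∈ˢ p → x ∉ q → p ⊈ q
∈⇒⊈ x x∈p x∉q p⊆q = x∉q (p⊆q x∈p)

-- The line that led to `b` is gone and `b` occurs nowhere else, so this is the last line at `b`.
half-claims : ∀ {z : Subset n} {b} bs Ls → Free (z ∪ ⋃ Ls) (b ∷ bs) →
  edge ⁅ b ⁆ z bs ⊈ ⋃ (half z bs ++ Ls)
half-claims {z = z} {b} bs Ls (u , ∉W) = ∈⇒⊈ b (y⊆edge bs (Subset.x∈⁅x⁆ b)) b∉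
  where
  b∉ : b ∉ ⋃ (half z bs ++ Ls)
  b∉ b∈ with ∈-⋃-half bs Ls b∈
  ... | inj₁ b∈bs = Unique.Unique[x∷xs]⇒x∉xs u b∈bs
  ... | inj₂ b∈W  = ∉W (here refl) b∈W

half-takeable : ∀ {z : Subset n} bs Ls → Free (z ∪ ⋃ Ls) bs → Takeable Ls (half z bs)
half-takeable []       Ls free = []
half-takeable (b ∷ bs) Ls free = half-claims bs Ls free ∷ half-takeable bs Ls (Free-tail free)

ζ-take-prefix : ∀ {z : Subset n} as bs Ls → Free (z ∪ ⋃ Ls) (as ++ bs) →
  ζ (half z (as ++ bs) ++ Ls) ≤ ζ (half z bs ++ Ls)
ζ-take-prefix []       bs Ls free = ℤ.≤-refl
ζ-take-prefix {z = z} (a ∷ as) bs Ls free = ℤ.≤-trans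
  (ζ-claim (edge ⁅ a ⁆ z (as ++ bs)) (half z (as ++ bs) ++ Ls) (half-claims (as ++ bs) Ls free))
  (ζ-take-prefix as bs Ls (Free-tail free))

-- In a ring the last line returns to the cut box `x`, so when the lines are drawn from the right
-- each of them claims its right-hand end. The box `b` may lie in `W`, as it does after the first
-- step of the induction.
half-backTakeable : ∀ {W : Subset n} x b bs → Unique (x ∷ b ∷ bs) → (∀ {c} → c ∈ x ∷ bs → c ∉ W) →
  BackTakeable W (half ⁅ x ⁆ (b ∷ bs))
half-backTakeable x b [] u ∉W = ∈⇒⊈ x (Subset.q⊆p∪q ⁅ b ⁆ _ (Subset.x∈⁅x⁆ x)) (∉W (here refl)) , tt
half-backTakeable {W = W} x b (c ∷ bs) ((x≢b ∷ x≢c ∷ x∉) ∷ (b≢c ∷ b∉) ∷ (c∉ ∷ u)) ∉W =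
  ∈⇒⊈ c (Subset.q⊆p∪q ⁅ b ⁆ _ (Subset.x∈⁅x⁆ c)) (∉W (there (here refl))) ,
  half-backTakeable x c bs ((x≢c ∷ x∉) ∷ c∉ ∷ u) ∉W′
  where
  ∉W′ : ∀ {d} → d ∈ x ∷ bs → d ∉ (⁅ b ⁆ ∪ ⁅ c ⁆) ∪ W
  ∉W′ (here refl) = ∉-∪ (∉-∪ (Subset.x≢y⇒x∉⁅y⁆ x≢b) (Subset.x≢y⇒x∉⁅y⁆ x≢c)) (∉W (here refl))
  ∉W′ (there d∈)  = ∉-∪ (∉-∪ (Subset.x≢y⇒x∉⁅y⁆ λ d≡b → All.lookup b∉ d∈ (sym d≡b))
                              (Subset.x≢y⇒x∉⁅y⁆ λ d≡c → All.lookup c∉ d∈ (sym d≡c)))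
                        (∉W (there (there d∈)))

card-insert : ∀ {b : Fin n} {W} → b ∉ W → card (⁅ b ⁆ ∪ W) ≡ suc (card W)
card-insert {b = zero}  {inside  ∷ W} b∉W = contradiction Vec.here b∉W
card-insert {b = zero}  {outside ∷ W} b∉W = cong (λ p → suc (card p)) (Subset.∪-identityˡ W)
card-insert {b = suc b} {inside  ∷ W} b∉W = cong suc (card-insert λ b∈W → b∉W (Vec.there b∈W))
card-insert {b = suc b} {outside ∷ W} b∉W = card-insert λ b∈W → b∉W (Vec.there b∈W)

card-pair : ∀ {b c : Fin n} {W} → b ≢ c → b ∉ W → c ∉ W →
  card ((⁅ b ⁆ ∪ ⁅ c ⁆) ∪ W) ≡ 2 ℕ.+ card W
card-pair {b = b} {c} {W} b≢c b∉W c∉W = trans (cong card (Subset.∪-assoc ⁅ b ⁆ ⁅ c ⁆ W))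
  (trans (card-insert (∉-∪ (Subset.x≢y⇒x∉⁅y⁆ b≢c) b∉W)) (cong suc (card-insert c∉W)))

half-pairs : ∀ {W : Subset n} x bs → Free W (x ∷ bs) →
  All (λ s → 2 ℕ.+ card W ℕ.≤ card (s ∪ W)) (half ⁅ x ⁆ bs)
half-pairs x []       _          = []
half-pairs x (b ∷ []) (((x≢b ∷ []) ∷ _) , ∉W) =
  ℕ.≤-reflexive (sym (card-pair (λ b≡x → x≢b (sym b≡x)) (∉W (there (here refl))) (∉W (here refl)))) ∷ []
half-pairs x (b ∷ c ∷ bs) (((x≢b ∷ x∉) ∷ (b≢c ∷ b∉) ∷ u) , ∉W) =
  ℕ.≤-reflexive (sym (card-pair b≢c (∉W (there (here refl))) (∉W (there (there (here refl)))))) ∷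
  half-pairs x (c ∷ bs) (x∉ ∷ u , λ { (here refl) → ∉W (here refl) ; (there d∈) → ∉W (there (there d∈)) })

suffix : ∀ {A : Set} k (xs : List A) → k ℕ.≤ length xs → ∃[ as ] ∃[ bs ] xs ≡ as ++ bs × length bs ≡ k
suffix k xs k≤ with k ℕ.≟ length xs
... | yes refl = [] , xs , refl , refl
suffix k []       z≤n | no k≢ = contradiction refl k≢
suffix k (x ∷ xs) k≤  | no k≢ with suffix k xs (ℕ.s≤s⁻¹ (ℕ.≤∧≢⇒< k≤ k≢))
... | as , bs , refl , eq = x ∷ as , bs , refl , eq

module _ {n} (R : List (Subset n)) (quiet : Quiet R) where

  control-string : ∀ bs → Free (⊥ ∪ ⋃ R) bs → 2 ℕ.≤ length bs →
    ζ (half ⊥ bs ++ R) ≤ total R + total R + + 4 - ζ R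
  control-string bs free 2≤ with suffix 2 bs 2≤
  ... | as , a ∷ b ∷ [] , refl , _ = ℤ.≤-trans (ζ-take-prefix as (a ∷ b ∷ []) R free)
    -- All boxes but the last two have been taken. Drawing the end line now leaves one line, which
    -- claims `a` and `b` together.
    (ℤ.≤-trans (ℤ.≤-reflexive (ζ-↭ (↭.swap (⁅ a ⁆ ∪ ⁅ b ⁆) (⁅ b ⁆ ∪ ⊥) ↭-refl)))
      (ℤ.≤-trans (ζ-control R quiet (⁅ b ⁆ ∪ ⊥) ((⁅ a ⁆ ∪ ⁅ b ⁆) ∷ []) b⊆ (ab⊈ ∷ [] , ab⊈ , tt) (s≤s z≤n))
        (ℤ.≤-reflexive (trans (cong (λ t → + t + + t - ζ R) (card-pair a≢b a∉ b∉)) (lemma (+ 2) (total R) (ζ R))))))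
    where
    free-ab : Free (⊥ ∪ ⋃ R) (a ∷ b ∷ [])
    free-ab = Free-++ʳ as free
    a∉ : a ∉ ⋃ R
    a∉ a∈ = proj₂ free-ab (here refl) (Subset.q⊆p∪q ⊥ _ a∈)
    b∉ : b ∉ ⋃ R
    b∉ b∈ = proj₂ free-ab (there (here refl)) (Subset.q⊆p∪q ⊥ _ b∈)
    a≢b : a ≢ b
    a≢b = All.head (AllPairs.head (proj₁ free-ab))
    ab⊈ : (⁅ a ⁆ ∪ ⁅ b ⁆) ⊈ ⋃ R
    ab⊈ = ∈⇒⊈ a (Subset.p⊆p∪q _ (Subset.x∈⁅x⁆ a)) a∉
    b⊆ : ⁅ b ⁆ ∪ ⊥ ⊆ (⁅ a ⁆ ∪ ⁅ b ⁆) ∪ ⋃ R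
    b⊆ = ∪-least (λ x∈ → Subset.p⊆p∪q (⋃ R) (Subset.q⊆p∪q ⁅ a ⁆ _ x∈)) Subset.⊥⊆
    lemma : ∀ k t z → k + t + (k + t) - z ≡ t + t + (k + k) - z
    lemma = solve-∀

  -- After `e` the four boxes lie on two disjoint lines, each of which claims two boxes whenever it
  -- is drawn. So the opponent collects four boxes, twice which is `+ 8`, and cannot gain by
  -- postponing either claim.
  control-pairs : ∀ e {a b c d} → Free (⋃ R) (a ∷ b ∷ c ∷ d ∷ []) →
    e ⊆ (⁅ a ⁆ ∪ ⁅ b ⁆) ∪ ((⁅ c ⁆ ∪ ⁅ d ⁆) ∪ ⋃ R) →
    ζ (e ∷ (⁅ a ⁆ ∪ ⁅ b ⁆) ∷ (⁅ c ⁆ ∪ ⁅ d ⁆) ∷ R) ≤ total R + total R + + 8 - ζ R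
  control-pairs e {a} {b} {c} {d} (((a≢b ∷ a≢c ∷ a≢d ∷ []) ∷ (b≢c ∷ b≢d ∷ []) ∷ (c≢d ∷ []) ∷ _) , ∉R) e⊆ =
    ℤ.≤-trans (ζ-control R quiet e ((⁅ a ⁆ ∪ ⁅ b ⁆) ∷ (⁅ c ⁆ ∪ ⁅ d ⁆) ∷ []) e⊆
        ( ∈⇒⊈ a (Subset.p⊆p∪q _ (Subset.x∈⁅x⁆ a)) a∉ ∷ ∈⇒⊈ c (Subset.p⊆p∪q _ (Subset.x∈⁅x⁆ c)) c∉R ∷ []
        , ∈⇒⊈ a (Subset.p⊆p∪q _ (Subset.x∈⁅x⁆ a)) a∉R
        , ∈⇒⊈ c (Subset.p⊆p∪q _ (Subset.x∈⁅x⁆ c))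
            (∉-∪ (∉-∪ (Subset.x≢y⇒x∉⁅y⁆ λ c≡a → a≢c (sym c≡a)) (Subset.x≢y⇒x∉⁅y⁆ λ c≡b → b≢c (sym c≡b))) c∉R)
        , tt)
        (s≤s (s≤s z≤n)))
      (ℤ.≤-reflexive (trans (cong (λ t → + t + + t - ζ R)
          (trans (card-pair a≢b a∉ b∉) (cong (2 ℕ.+_) (card-pair c≢d c∉R (∉R (there (there (there (here refl)))))))))
        (lemma (+ 4) (total R) (ζ R))))
    where
    a∉R = ∉R (here refl)
    c∉R = ∉R (there (there (here refl)))
    a∉ : a ∉ (⁅ c ⁆ ∪ ⁅ d ⁆) ∪ ⋃ R
    a∉ = ∉-∪ (∉-∪ (Subset.x≢y⇒x∉⁅y⁆ a≢c) (Subset.x≢y⇒x∉⁅y⁆ a≢d)) a∉R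
    b∉ : b ∉ (⁅ c ⁆ ∪ ⁅ d ⁆) ∪ ⋃ R
    b∉ = ∉-∪ (∉-∪ (Subset.x≢y⇒x∉⁅y⁆ b≢c) (Subset.x≢y⇒x∉⁅y⁆ b≢d)) (∉R (there (here refl)))
    lemma : ∀ k t z → k + t + (k + t) - z ≡ t + t + (k + k) - z
    lemma = solve-∀

-- Opening a path at any of its lines

end : Subset n → List (Fin n) → Subset n
end z []      = z
end z (p ∷ _) = ⁅ p ⁆

-- The line between `q` and the head of `ps` is the drawn line as long as `q` lies beyond it, and
-- the first line of `half z (q ∷ ps)` once the drawn line has moved past `q`.
edge-flip : ∀ (z : Subset n) ps qs q → edge ⁅ q ⁆ z ps ≡ edge (end z ps) z (q ∷ qs)
edge-flip z []       qs q = Subset.∪-comm ⁅ q ⁆ z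
edge-flip z (p ∷ ps) qs q = Subset.∪-comm ⁅ q ⁆ ⁅ p ⁆

-- The boxes on either side of the drawn line, listed outwards from it.
opening : ∀ (z : Subset n) ps qs {s} → s ∈ edge (end z ps) z qs ∷ half z qs →
  ∃[ ps′ ] ∃[ qs′ ] qs′ ++ ps′ ↭ qs ++ ps × s ≡ edge (end z ps′) z qs′ ×
    edge (end z ps) z qs ∷ half z qs ++ half z ps ↭ s ∷ half z qs′ ++ half z ps′
opening z ps qs       (here refl) = ps , qs , ↭-refl , refl , ↭-refl
opening z ps (q ∷ qs) (there s∈) with opening z (q ∷ ps) qs s∈
... | ps′ , qs′ , σ , eq , τ = ps′ , qs′ , ↭-trans σ (↭.shift q qs ps) , eq ,
  ↭-trans (↭-sym (↭.shift _ (half z (q ∷ qs)) (half z ps)))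
    (↭-trans (↭-reflexive (cong (λ e → half z (q ∷ qs) ++ e ∷ half z ps) (sym (edge-flip z ps qs q)))) τ)

anchor⊆half : ∀ (z : Subset n) b bs → z ⊆ ⋃ (half z (b ∷ bs))
anchor⊆half z b []       x∈ = Subset.p⊆p∪q _ (Subset.q⊆p∪q ⁅ b ⁆ z x∈)
anchor⊆half z b (c ∷ bs) x∈ = Subset.q⊆p∪q (⁅ b ⁆ ∪ ⁅ c ⁆) _ (anchor⊆half z c bs x∈)

head⊆half : ∀ (z : Subset n) b bs → ⁅ b ⁆ ⊆ ⋃ (half z (b ∷ bs))
head⊆half z b bs x∈ = Subset.p⊆p∪q _ (y⊆edge bs x∈)

edge⊆halves : ∀ (z : Subset n) ps qs → 1 ℕ.≤ length (qs ++ ps) →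
  edge (end z ps) z qs ⊆ ⋃ (half z qs ++ half z ps)
edge⊆halves z (p ∷ ps) []       _ = ∪-least (head⊆half z p ps) (anchor⊆half z p ps)
edge⊆halves z []       (q ∷ qs) _ = ∪-least
  (λ x∈ → ⋃-++ˡ (half z (q ∷ qs)) [] (anchor⊆half z q qs x∈))
  (λ x∈ → ⋃-++ˡ (half z (q ∷ qs)) [] (head⊆half z q qs x∈))
edge⊆halves z (p ∷ ps) (q ∷ qs) _ = ∪-least
  (λ x∈ → ⋃-++ʳ (half z (q ∷ qs)) (half z (p ∷ ps)) (head⊆half z p ps x∈))
  (λ x∈ → ⋃-++ˡ (half z (q ∷ qs)) (half z (p ∷ ps)) (head⊆half z q qs x∈))

Free-half : ∀ {z : Subset n} qs ps R → Free (z ∪ ⋃ R) (qs ++ ps) → Free (z ∪ ⋃ (half z qs ++ R)) ps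
Free-half {z = z} qs ps R free = proj₁ (Free-++ʳ qs free) , ∉
  where
  disjoint : ∀ qs → Unique (qs ++ ps) → ∀ {p} → p ∈ qs → p ∈ ps → Empty.⊥
  disjoint (q ∷ qs) (q∉ ∷ u) (here refl)  p∈ps = All.lookup q∉ (Mem.∈-++⁺ʳ qs p∈ps) refl
  disjoint (q ∷ qs) (q∉ ∷ u) (there p∈qs) p∈ps = disjoint qs u p∈qs p∈ps
  ∉ : ∀ {p} → p ∈ ps → p ∉ z ∪ ⋃ (half z qs ++ R)
  ∉ p∈ps = ∉-∪ (λ p∈z → proj₂ free (Mem.∈-++⁺ʳ qs p∈ps) (Subset.p⊆p∪q _ p∈z)) λ p∈ →
    Sum.[ (λ p∈qs → disjoint qs (proj₁ free) p∈qs p∈ps) , proj₂ free (Mem.∈-++⁺ʳ qs p∈ps) ] (∈-⋃-half qs R p∈)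

swap-halves : ∀ (z : Subset n) qs ps R → half z qs ++ half z ps ++ R ↭ half z ps ++ half z qs ++ R
swap-halves z qs ps R = ↭.shifts (half z qs) (half z ps)

ζ-take-half : ∀ {z : Subset n} qs ps R → Free (z ∪ ⋃ R) (qs ++ ps) →
  ζ (half z qs ++ half z ps ++ R) ≤ ζ (half z qs ++ R)
ζ-take-half {z = z} qs ps R free = ℤ.≤-trans (ℤ.≤-reflexive (ζ-↭ (swap-halves z qs ps R)))
  (ζ-take (half-takeable ps (half z qs ++ R) (Free-half qs ps R free)))

ζ-take-halves : ∀ {z : Subset n} qs ps R → Free (z ∪ ⋃ R) (qs ++ ps) →
  ζ (half z qs ++ half z ps ++ R) ≤ ζ R
ζ-take-halves qs ps R free = ℤ.≤-trans (ζ-take-half qs ps R free)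
  (ζ-take (half-takeable qs R (Free-++ʳ ps (Free-↭ (↭.++-comm qs ps) free))))

-- Opening a chain or a loop next to a rest

data Piece (n : ℕ) : Set where
  string : List (Fin n) → Piece n
  ring   : Fin n → List (Fin n) → Piece n

-- A loop is cut at one of its boxes, from which it returns to the same box.
anchor : Piece n → Subset n
anchor (string _) = ⊥
anchor (ring x _) = ⁅ x ⁆

interior : Piece n → List (Fin n)
interior (string bs) = bs
interior (ring _ bs) = bs

boxesOf : Piece n → List (Fin n)
boxesOf (string bs) = bs
boxesOf (ring x bs) = x ∷ bs

linesOf : Piece n → List (Subset n)
linesOf P = edge (anchor P) (anchor P) (interior P) ∷ half (anchor P) (interior P)

-- The number of boxes given away by a player who declines to take the whole piece.
handout : Piece n → ℕ
handout (string _) = 2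
handout (ring _ _) = 4

Free-interior : ∀ P {W : Subset n} → Free W (boxesOf P) → Free (anchor P ∪ W) (interior P)
Free-interior (string bs) {W} free rewrite Subset.∪-identityˡ W = free
Free-interior (ring x bs) ((x∉ ∷ u) , ∉W) = u ,
  λ b∈ → ∉-∪ (Subset.x≢y⇒x∉⁅y⁆ λ b≡x → All.lookup x∉ b∈ (sym b≡x)) (∉W (there b∈))

module _ {n} (R : List (Subset n)) (quiet : Quiet R) where

  -- Of the three or more boxes of a string at least two lie on one side of the drawn line; the
  -- other side is taken whole and these two are kept for the end. In a ring the boxes kept are the
  -- cut box and three others, which lie all on one side (`whole`) or two and one (`parted`). Either
  -- way they form a path with three lines inside it, and the middle one is drawn to hand them over.
  control : ∀ P qs ps → qs ++ ps ↭ interior P → 3 ℕ.≤ length (qs ++ ps) → Free (⋃ R) (boxesOf P) →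
    ζ (half (anchor P) qs ++ half (anchor P) ps ++ R) ≤ total R + total R + + (handout P ℕ.+ handout P) - ζ R
  control P@(string bs) qs ps σ 3≤ free with 2 ℕ.≤? length qs
  ... | yes 2≤ = ℤ.≤-trans (ζ-take-half qs ps R free′)
    (control-string R quiet qs (Free-++ʳ ps (Free-↭ (↭.++-comm qs ps) free′)) 2≤)
    where free′ = Free-↭ (↭-sym σ) (Free-interior P free)
  ... | no  2≰ = ℤ.≤-trans (ℤ.≤-reflexive (ζ-↭ (swap-halves ⊥ qs ps R)))
    (ℤ.≤-trans (ζ-take-half ps qs R (Free-↭ (↭.++-comm qs ps) free′))
      (control-string R quiet ps (Free-++ʳ qs free′) 2≤))
    where
    free′ = Free-↭ (↭-sym σ) (Free-interior P free)
    2≤ : 2 ℕ.≤ length ps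
    2≤ = ℕ.+-cancelˡ-≤ 1 2 _ (ℕ.≤-trans 3≤ (ℕ.≤-trans (ℕ.≤-reflexive (List.length-++ qs))
      (ℕ.+-monoˡ-≤ (length ps) (ℕ.s≤s⁻¹ (ℕ.≰⇒> 2≰)))))
  control P@(ring x bs) qs ps σ 3≤ free = cases qs ps 3≤ (Free-↭ (↭.prep x (↭-sym σ)) free)
    where
    z = ⁅ x ⁆
    bound = total R + total R + + 8 - ζ R

    whole : ∀ qs → 3 ℕ.≤ length qs → Free (⋃ R) (x ∷ qs) → ζ (half z qs ++ R) ≤ bound
    whole qs 3≤ free with suffix 3 qs 3≤
    ... | as , a ∷ b ∷ c ∷ [] , refl , _ =
      ℤ.≤-trans (ζ-take-prefix as (a ∷ b ∷ c ∷ []) R (Free-interior (ring x qs) free))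
        (ℤ.≤-trans (ℤ.≤-reflexive (ζ-↭ (↭.swap (⁅ a ⁆ ∪ ⁅ b ⁆) (⁅ b ⁆ ∪ ⁅ c ⁆) ↭-refl)))
          (control-pairs R quiet (⁅ b ⁆ ∪ ⁅ c ⁆)
            (Free-++ʳ as (Free-↭ (↭-trans (↭.∷↭∷ʳ x (as ++ _)) (↭-reflexive (List.++-assoc as _ _))) free))
            (∪-least (λ x∈ → Subset.p⊆p∪q _ (Subset.q⊆p∪q ⁅ a ⁆ _ x∈))
                     (λ x∈ → Subset.q⊆p∪q (⁅ a ⁆ ∪ ⁅ b ⁆) _ (Subset.p⊆p∪q _ (Subset.p⊆p∪q _ x∈))))))

    parted : ∀ qs ps → 2 ℕ.≤ length qs → 1 ℕ.≤ length ps → Free (⋃ R) (x ∷ qs ++ ps) →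
      ζ (half z qs ++ half z ps ++ R) ≤ bound
    parted qs ps 2≤ 1≤ free with suffix 2 qs 2≤ | suffix 1 ps 1≤
    ... | as , a ∷ b ∷ [] , refl , _ | cs , c ∷ [] , refl , _ =
      ℤ.≤-trans (ζ-take-prefix as (a ∷ b ∷ []) (half z ps ++ R)
          (Free-half ps qs R (Free-↭ (↭.++-comm qs ps) free′)))
        (ℤ.≤-trans (ℤ.≤-reflexive (ζ-↭ (swap-halves z (a ∷ b ∷ []) ps R)))
          (ℤ.≤-trans (ζ-take-prefix cs (c ∷ []) (half z (a ∷ b ∷ []) ++ R)
              (Free-half (a ∷ b ∷ []) ps R (Free-++ʳ as (subst (Free _) (List.++-assoc as _ ps) free′))))
            (ℤ.≤-trans (ℤ.≤-reflexive (ζ-↭ (↭.swap (⁅ c ⁆ ∪ ⁅ x ⁆) (⁅ a ⁆ ∪ ⁅ b ⁆) ↭-refl)))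
              (ℤ.≤-trans (ℤ.≤-reflexive (ζ-↭ (↭-trans (↭.prep (⁅ a ⁆ ∪ ⁅ b ⁆) (↭.swap (⁅ c ⁆ ∪ ⁅ x ⁆) (⁅ b ⁆ ∪ ⁅ x ⁆) ↭-refl))
                                                       (↭.swap (⁅ a ⁆ ∪ ⁅ b ⁆) (⁅ b ⁆ ∪ ⁅ x ⁆) ↭-refl))))
                (control-pairs R quiet (⁅ b ⁆ ∪ ⁅ x ⁆) free-abcx
                  (∪-least (λ y∈ → Subset.p⊆p∪q _ (Subset.q⊆p∪q ⁅ a ⁆ _ y∈))
                           (λ y∈ → Subset.q⊆p∪q (⁅ a ⁆ ∪ ⁅ b ⁆) _ (Subset.p⊆p∪q _ (Subset.q⊆p∪q ⁅ c ⁆ _ y∈)))))))))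
      where
      free′ = Free-interior (ring x (qs ++ ps)) free
      free-abcx : Free (⋃ R) (a ∷ b ∷ c ∷ x ∷ [])
      free-abcx = Free-↭ (↭-trans (↭.++-comm (a ∷ b ∷ []) (c ∷ x ∷ [])) (↭.++-comm (c ∷ x ∷ []) (a ∷ b ∷ [])))
        (Free-++ʳ cs (Free-↭ (↭-trans (↭.++⁺ˡ (a ∷ b ∷ []) (↭-trans (↭.∷↭∷ʳ x ps) (↭-reflexive (List.++-assoc cs _ _))))
                                       (↭.shifts (a ∷ b ∷ []) cs))
          (Free-++ʳ as (Free-↭ (↭-trans (↭-sym (↭.shift x qs ps)) (↭-reflexive (List.++-assoc as _ _))) free))))

    cases : ∀ qs ps → 3 ℕ.≤ length (qs ++ ps) → Free (⋃ R) (x ∷ qs ++ ps) →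
      ζ (half z qs ++ half z ps ++ R) ≤ bound
    cases qs               []               3≤ free rewrite List.++-identityʳ qs = whole qs 3≤ free
    cases []               ps@(_ ∷ _)       3≤ free = whole ps 3≤ free
    cases qs@(_ ∷ _ ∷ _)   ps@(_ ∷ _)       3≤ free = parted qs ps (s≤s (s≤s z≤n)) (s≤s z≤n) free
    cases qs@(_ ∷ [])      ps@(_ ∷ _ ∷ _)   3≤ free =
      ℤ.≤-trans (ℤ.≤-reflexive (ζ-↭ (swap-halves z qs ps R)))
        (parted ps qs (s≤s (s≤s z≤n)) (s≤s z≤n) (Free-↭ (↭.prep x (↭.++-comm qs ps)) free))
    cases (_ ∷ [])         (_ ∷ [])         (s≤s (s≤s ())) free

  -- The two bounds on `ζ rest` are the two replies: taking the piece whole, or handing over its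
  -- end. `no-claim` serves a second purpose, the proof that endgames are quiet.
  record Opening (P : Piece n) (s : Subset n) : Set where
    field
      rest        : List (Subset n)
      line-first  : linesOf P ++ R ↭ s ∷ rest
      no-claim    : s ⊆ ⋃ rest
      ζ-taken     : ζ rest ≤ ζ R
      ζ-controlled : ζ rest ≤ total R + total R + + (handout P ℕ.+ handout P) - ζ R

  openAny : ∀ P → Free (⋃ R) (boxesOf P) → 3 ℕ.≤ length (interior P) → ∀ {s} → s ∈ linesOf P → Opening P s
  openAny P free 3≤ s∈ with opening (anchor P) [] (interior P) s∈
  ... | ps , qs , σ , refl , τ = record
    { rest       = half z qs ++ half z ps ++ R
    ; line-first = ↭-trans (↭-reflexive (cong (λ Ls → edge z z (interior P) ∷ Ls ++ R) (sym (List.++-identityʳ _))))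
        (↭-trans (↭.++⁺ʳ R τ) (↭.prep _ (↭-reflexive (List.++-assoc (half z qs) _ _))))
    ; no-claim   = λ x∈ → ⊆-respʳ (cong ⋃ (List.++-assoc (half z qs) _ _)) (⋃-++ˡ (half z qs ++ half z ps) R)
        (edge⊆halves z ps qs (ℕ.≤-trans (s≤s z≤n) 3≤′) x∈)
    ; ζ-taken    = ζ-take-halves qs ps R (Free-↭ (↭-sym σ′) (Free-interior P free))
    ; ζ-controlled = control P qs ps σ′ 3≤′ free
    }
    where
    z = anchor P
    σ′ : qs ++ ps ↭ interior P
    σ′ = ↭-trans σ (↭-reflexive (List.++-identityʳ _))
    3≤′ : 3 ℕ.≤ length (qs ++ ps)
    3≤′ = ℕ.≤-trans 3≤ (ℕ.≤-reflexive (sym (↭.↭-length σ′)))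

  -- The player who opens picks the first line, so only here must all replies be bounded. What is
  -- left is a single half, in which claims proceed from one end; a line drawn in the middle would
  -- leave two.
  ζ-half : ∀ P → Free (⋃ R) (boxesOf P) → 3 ℕ.≤ length (interior P) → ∀ {η} → η ≤ ζ R →
    η ≤ total R + total R + + (handout P ℕ.+ handout P) - ζ R →
    η ≤ ζ (half (anchor P) (interior P) ++ R)
  ζ-half P@(string bs) free 3≤ η≤ η≤′ =
    ζ-lower-chain R quiet _ _ (half-takeable bs R (Free-interior P free)) η≤ η≤′
  ζ-half P@(ring x bs@(b ∷ cs)) free@(u , ∉R) 3≤ η≤ η≤′ =
    ζ-lower-loop R quiet _ _
      ( half-takeable bs R (Free-interior P free)
      , half-backTakeable x b cs u λ { (here refl) → ∉R (here refl) ; (there c∈) → ∉R (there (there c∈)) })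
      (half-pairs x bs free) η≤ η≤′

-- Disjoint components and the value of opening one

concatMap-↭ : ∀ {A B : Set} (f : A → List B) {xs ys} → xs ↭ ys → concatMap f xs ↭ concatMap f ys
concatMap-↭ f ↭.refl         = ↭-refl
concatMap-↭ f (↭.prep x σ)   = ↭.++⁺ˡ (f x) (concatMap-↭ f σ)
concatMap-↭ f (↭.swap x y σ) =
  ↭-trans (↭.shifts (f x) (f y)) (↭.++⁺ˡ (f y) (↭.++⁺ˡ (f x) (concatMap-↭ f σ)))
concatMap-↭ f (↭.trans σ τ)  = ↭-trans (concatMap-↭ f σ) (concatMap-↭ f τ)

data Component : Set where
  chainOf loopOf : ℕ → Component

shape : Piece n → Component
shape (string bs) = chainOf (length bs)
shape (ring x bs) = loopOf (suc (length bs))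

-- The value of opening a component when the rest has value x: the opponent either
-- takes everything, or all but a handout and then moves second in the rest.
openValue : Component → ℤ → ℤ
openValue (chainOf n) x = + n - + 2 + + ∣ x - + 2 ∣
openValue (loopOf n)  x = + n - + 4 + + ∣ x - + 4 ∣

openValue-shape : ∀ (P : Piece n) x →
  openValue (shape P) x ≡ + length (boxesOf P) - + handout P + + ∣ x - + handout P ∣
openValue-shape (string bs) x = refl
openValue-shape (ring _ bs) x = refl

LongComponent : Component → Set
LongComponent (chainOf n) = 3 ℕ.≤ n
LongComponent (loopOf n)  = 4 ℕ.≤ n

long-interior : ∀ (P : Piece n) → LongComponent (shape P) → 3 ℕ.≤ length (interior P)
long-interior (string _) long       = long
long-interior (ring _ _) (s≤s long) = long

allLines : List (Piece n) → List (Subset n)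
allLines = concatMap linesOf

allBoxes : List (Piece n) → List (Fin n)
allBoxes = concatMap boxesOf

onLines⇒inBoxes : ∀ (P : Piece n) {x} → x ∈ˢ ⋃ (linesOf P) → x ∈ boxesOf P
onLines⇒inBoxes P {x} x∈ = Sum.[ onEdge (interior P) (λ b∈ → b∈) , onHalf ]
    (Subset.x∈p∪q⁻ (edge (anchor P) (anchor P) (interior P)) (⋃ (half (anchor P) (interior P))) x∈)
  where
  atAnchor : ∀ P → x ∈ˢ anchor P → x ∈ boxesOf P
  atAnchor (string _) x∈ = contradiction x∈ Subset.∉⊥
  atAnchor (ring y _) x∈ = here (Subset.x∈⁅y⁆⇒x≡y y x∈)
  inInterior : ∀ P → x ∈ interior P → x ∈ boxesOf P
  inInterior (string _) x∈ = x∈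
  inInterior (ring _ _) x∈ = there x∈
  onEdge : ∀ bs → (∀ {y} → y ∈ bs → y ∈ interior P) → x ∈ˢ edge (anchor P) (anchor P) bs → x ∈ boxesOf P
  onEdge []       _   x∈ = Sum.[ atAnchor P , atAnchor P ] (Subset.x∈p∪q⁻ (anchor P) (anchor P) x∈)
  onEdge (b ∷ bs) bs⊆ x∈ =
    Sum.[ atAnchor P , (λ x∈b → inInterior P (bs⊆ (here (Subset.x∈⁅y⁆⇒x≡y b x∈b)))) ]
      (Subset.x∈p∪q⁻ (anchor P) ⁅ b ⁆ x∈)
  onHalf : x ∈ˢ ⋃ (half (anchor P) (interior P)) → x ∈ boxesOf P
  onHalf x∈ with ∈-⋃-half (interior P) [] (⋃-++ˡ (half (anchor P) (interior P)) [] x∈)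
  ... | inj₁ x∈bs = inInterior P x∈bs
  ... | inj₂ x∈a  = Sum.[ atAnchor P , (λ x∈⊥ → contradiction x∈⊥ Subset.∉⊥) ] (Subset.x∈p∪q⁻ (anchor P) ⊥ x∈a)

inHalf : ∀ (z : Subset n) {b bs} → b ∈ bs → b ∈ˢ ⋃ (half z bs)
inHalf z {b} {bs = _ ∷ bs} (here refl) = head⊆half z b bs (Subset.x∈⁅x⁆ b)
inHalf z (there b∈)  = Subset.q⊆p∪q _ _ (inHalf z b∈)

inBoxes⇒onLines : ∀ (P : Piece n) {x} → x ∈ boxesOf P → x ∈ˢ ⋃ (linesOf P)
inBoxes⇒onLines (string _)      x∈          = Subset.q⊆p∪q _ _ (inHalf ⊥ x∈)
inBoxes⇒onLines (ring x bs) (here refl) = Subset.p⊆p∪q _ (y⊆edge bs (Subset.x∈⁅x⁆ x))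
inBoxes⇒onLines (ring x bs) (there x∈)  = Subset.q⊆p∪q _ _ (inHalf ⁅ x ⁆ x∈)

onAllLines⇒inAllBoxes : ∀ (N : List (Piece n)) {x} → x ∈ˢ ⋃ (allLines N) → x ∈ allBoxes N
onAllLines⇒inAllBoxes []      x∈ = contradiction x∈ Subset.∉⊥
onAllLines⇒inAllBoxes (P ∷ N) {x} x∈
  with Subset.x∈p∪q⁻ (⋃ (linesOf P)) _ (subst (x ∈ˢ_) (⋃-++ (linesOf P) (allLines N)) x∈)
... | inj₁ x∈P = Mem.∈-++⁺ˡ (onLines⇒inBoxes P x∈P)
... | inj₂ x∈N = Mem.∈-++⁺ʳ (boxesOf P) (onAllLines⇒inAllBoxes N x∈N)

∈-⋃⁅⁆⁻ : ∀ (bs : List (Fin n)) {x} → x ∈ˢ ⋃ (map ⁅_⁆ bs) → x ∈ bs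
∈-⋃⁅⁆⁻ []       x∈ = contradiction x∈ Subset.∉⊥
∈-⋃⁅⁆⁻ (c ∷ cs) x∈ with Subset.x∈p∪q⁻ ⁅ c ⁆ _ x∈
... | inj₁ x∈c  = here (Subset.x∈⁅y⁆⇒x≡y c x∈c)
... | inj₂ x∈cs = there (∈-⋃⁅⁆⁻ cs x∈cs)

card-⋃⁅⁆ : ∀ {W : Subset n} bs → Free W bs → card (⋃ (map ⁅_⁆ bs) ∪ W) ≡ length bs ℕ.+ card W
card-⋃⁅⁆ {W = W} []       free = cong card (Subset.∪-identityˡ W)
card-⋃⁅⁆ {W = W} (b ∷ bs) free@(u , ∉W) = trans (cong card (Subset.∪-assoc ⁅ b ⁆ (⋃ (map ⁅_⁆ bs)) W))
  (trans (card-insert (∉-∪ b∉ (∉W (here refl)))) (cong suc (card-⋃⁅⁆ bs (Free-tail free))))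
  where
  b∉ : b ∉ ⋃ (map ⁅_⁆ bs)
  b∉ b∈ = Unique.Unique[x∷xs]⇒x∉xs u (∈-⋃⁅⁆⁻ bs b∈)

⋃-linesOf : ∀ (P : Piece n) → ⋃ (linesOf P) ≡ ⋃ (map ⁅_⁆ (boxesOf P))
⋃-linesOf P = Subset.⊆-antisym (λ x∈ → singletons (onLines⇒inBoxes P x∈))
  (λ x∈ → inBoxes⇒onLines P (∈-⋃⁅⁆⁻ (boxesOf P) x∈))
  where
  singletons : ∀ {bs x} → x ∈ bs → x ∈ˢ ⋃ (map ⁅_⁆ bs)
  singletons {x = x} (here refl) = Subset.p⊆p∪q _ (Subset.x∈⁅x⁆ x)
  singletons (there x∈)          = Subset.q⊆p∪q _ _ (singletons x∈)

total-piece : ∀ P (R : List (Subset n)) → Free (⋃ R) (boxesOf P) →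
  total (linesOf P ++ R) ≡ + length (boxesOf P) + total R
total-piece P R free = cong +_ (trans (cong card (trans (⋃-++ (linesOf P) R) (cong (_∪ ⋃ R) (⋃-linesOf P))))
  (card-⋃⁅⁆ (boxesOf P) free))

Proper : List (Piece n) → Set
Proper N = Unique (allBoxes N) × All (λ P → LongComponent (shape P)) N

Proper-tail : ∀ {P : Piece n} {N} → Proper (P ∷ N) → Proper N
Proper-tail {P = P} (u , _ ∷ long) = proj₁ (Free-++ʳ {W = ⊥} (boxesOf P) (u , λ _ → Subset.∉⊥)) , long

Proper-Free : ∀ {P : Piece n} {N} → Proper (P ∷ N) → Free (⋃ (allLines N)) (boxesOf P)
Proper-Free {P = P} {N} (u , _) = go (boxesOf P) u
  where
  go : ∀ bs → Unique (bs ++ allBoxes N) → Free (⋃ (allLines N)) bs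
  go []       u        = [] , λ ()
  go (b ∷ bs) (b∉ ∷ u) = All.++⁻ˡ bs b∉ ∷ proj₁ (go bs u) ,
    λ { (here refl) b∈ → All.lookup (All.++⁻ʳ bs b∉) (onAllLines⇒inAllBoxes N b∈) refl
      ; (there c∈) → proj₂ (go bs u) c∈ }

Proper-↭ : ∀ {M N : List (Piece n)} → M ↭ N → Proper M → Proper N
Proper-↭ σ (u , long) = ↭ₛ.Unique-resp-↭ (setoid _) (↭.↭⇒↭ₛ (concatMap-↭ boxesOf σ)) u , ↭.All-resp-↭ σ long

-- Induction on the pieces: `openAny` for the head asks for a quiet tail and in return supplies
-- `no-claim`.
quiet : ∀ (N : List (Piece n)) → Proper N → Quiet (allLines N)
quiet []      _ σ = contradiction (↭-sym σ) ↭.¬x∷xs↭[]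
quiet (P ∷ N) proper@(_ , long ∷ _) {s} {Ms} σ
  with Mem.∈-++⁻ (linesOf P) (↭.∈-resp-↭ (↭-sym σ) (here refl))
... | inj₁ s∈P = ⊆-respʳ (⋃-↭ (↭.drop-∷ (↭-trans (↭-sym line-first) σ))) no-claim
  where
  open Opening (openAny (allLines N) (quiet N (Proper-tail proper))
    P (Proper-Free proper) (long-interior P long) s∈P)
... | inj₂ s∈N with ∈⇒↭ s∈N
...   | R , τ = λ x∈ → ⊆-respʳ
  (⋃-↭ (↭.drop-∷ (↭-trans (↭-trans (↭-sym (↭.shift s (linesOf P) R)) (↭.++⁺ˡ (linesOf P) (↭-sym τ))) σ)))
  (⋃-++ʳ (linesOf P) R) (quiet N (Proper-tail proper) τ x∈)

pieceValue : List (Piece n) → ℤ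
pieceValue N = value (fromList (allLines N))

i≤∣i∣ : ∀ i → i ≤ + ∣ i ∣
i≤∣i∣ (+ n)           = ℤ.≤-refl
i≤∣i∣ -[1+ n ] = -≤+

-i≤∣i∣ : ∀ i → - i ≤ + ∣ i ∣
-i≤∣i∣ i = subst (λ k → - i ≤ + k) (ℤ.∣-i∣≡∣i∣ i) (i≤∣i∣ (- i))

-- The sign of `x - h` tells which reply the opponent prefers: handing over `h` boxes if it is
-- nonnegative, taking everything otherwise. The matching bound on `z` is the one used.
opened-≥ : ∀ k h x t z → z ≤ t + x → z ≤ t + t + (h + h) - (t + x) →
  k - h + + ∣ x - h ∣ ≤ k + t + (k + t) - z - (k + t)
opened-≥ k h x t z taken controlled with ℤ.+∣i∣≡i⊎+∣i∣≡-i (x - h)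
... | inj₁ eq rewrite eq = ≤-by-difference controlled (lemma k h x t z)
  where
  lemma : ∀ k h x t z → k + t + (k + t) - z - (k + t) - (k - h + (x - h)) ≡ t + t + (h + h) - (t + x) - z
  lemma = solve-∀
... | inj₂ eq rewrite eq = ≤-by-difference taken (lemma k h x t z)
  where
  lemma : ∀ k h x t z → k + t + (k + t) - z - (k + t) - (k - h + - (x - h)) ≡ t + x - z
  lemma = solve-∀

module _ (P : Piece n) (N : List (Piece n)) (proper : Proper (P ∷ N)) where
  private
    R = allLines N
    free = Proper-Free proper
    quietR = quiet N (Proper-tail proper)
    long = long-interior P (All.head (proj₂ proper))
    h = + handout P
    x = pieceValue N
    t = total R
    k = + length (boxesOf P)

    total-rest : ∀ {s rest} → linesOf P ++ R ↭ s ∷ rest → s ⊆ ⋃ rest → total rest ≡ k + t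
    total-rest {s} {rest} σ s⊆ = trans (sym (trans (total-↭ σ) (cong (λ p → + card p) (absorbed s rest s⊆))))
      (total-piece P R free)

    value≡ : pieceValue (P ∷ N) ≡ ζ (linesOf P ++ R) - (k + t)
    value≡ = trans (lemma (total (linesOf P ++ R)) (pieceValue (P ∷ N)))
      (cong₂ _-_ (sym (ζ-unfold (linesOf P ++ R))) (total-piece P R free))
      where
      lemma : ∀ t w → w ≡ t + w - t
      lemma = solve-∀

  pieceValue-≥ : ∀ {s Ms} → s ∈ linesOf P → linesOf P ++ R ↭ s ∷ Ms →
    ζ (linesOf P ++ R) ≡ total Ms + total Ms - ζ Ms → openValue (shape P) x ≤ pieceValue (P ∷ N)
  pieceValue-≥ {s} {Ms} s∈ σ ζ≡ = ℤ.≤-trans (ℤ.≤-reflexive (openValue-shape P x))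
    (ℤ.≤-trans (opened-≥ k h x t (ζ Ms) taken controlled) (ℤ.≤-reflexive (sym passed)))
    where
    open Opening (openAny R quietR P free long s∈)
    τ : rest ↭ Ms
    τ = ↭.drop-∷ (↭-trans (↭-sym line-first) σ)
    s⊆ : s ⊆ ⋃ Ms
    s⊆ = ⊆-respʳ (⋃-↭ τ) no-claim
    passed : pieceValue (P ∷ N) ≡ k + t + (k + t) - ζ Ms - (k + t)
    passed = trans value≡ (cong (_- (k + t)) (trans ζ≡ (cong (λ T → T + T - ζ Ms) (total-rest {s} {Ms} σ s⊆))))
    taken : ζ Ms ≤ t + x
    taken = subst₂ _≤_ (ζ-↭ τ) (ζ-unfold R) ζ-taken
    controlled : ζ Ms ≤ t + t + (h + h) - (t + x)
    controlled = subst₂ (λ y z → y ≤ t + t + (h + h) - z) (ζ-↭ τ) (ζ-unfold R) ζ-controlled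

  pieceValue-≤ : pieceValue (P ∷ N) ≤ openValue (shape P) x
  pieceValue-≤ = subst₂ _≤_ (sym value≡) (sym (openValue-shape P x)) (≤-by-difference
    (ℤ.+-mono-≤ (ζ-pass s rest s⊆)
      -- `t + h - a` is the smaller of `t + x` and `t + h + h - x`, which are the normalised values
      -- after the two replies.
      (ζ-half R quietR P free long {t + h - a}
        (subst (t + h - a ≤_) (sym (ζ-unfold R)) (≤-by-difference (-i≤∣i∣ (x - h)) (lemma₁ t x h a)))
        (subst (λ z → t + h - a ≤ t + t + (h + h) - z) (sym (ζ-unfold R))
          (≤-by-difference (i≤∣i∣ (x - h)) (lemma₂ t x h a)))))
    (trans (lemma₃ k t h a (ζ (s ∷ rest)) (ζ rest))
      (cong (λ T → (T + T - ζ rest + ζ rest) - (ζ (s ∷ rest) + (t + h - a))) (sym (total-rest ↭-refl s⊆)))))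
    where
    a = + ∣ x - h ∣
    s = edge (anchor P) (anchor P) (interior P)
    rest = half (anchor P) (interior P) ++ R
    s⊆ : s ⊆ ⋃ rest
    s⊆ x∈ = ⋃-++ˡ (half (anchor P) (interior P)) R
      (⊆-respʳ (cong ⋃ (List.++-identityʳ (half (anchor P) (interior P))))
        (edge⊆halves (anchor P) [] (interior P)
          (subst (λ bs → 1 ℕ.≤ length bs) (sym (List.++-identityʳ (interior P))) (ℕ.≤-trans (s≤s z≤n) long)))
        x∈)
    lemma₁ : ∀ t x h a → t + x - (t + h - a) ≡ a - - (x - h)
    lemma₁ = solve-∀
    lemma₂ : ∀ t x h a → t + t + (h + h) - (t + x) - (t + h - a) ≡ a - (x - h)
    lemma₂ = solve-∀
    lemma₃ : ∀ k t h a y z → k - h + a - (y - (k + t)) ≡ (k + t + (k + t) - z + z) - (y + (t + h - a))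
    lemma₃ = solve-∀

allLines-↭ : ∀ {M N : List (Piece n)} → M ↭ N → allLines M ↭ allLines N
allLines-↭ = concatMap-↭ linesOf

pieceValue-↭ : ∀ {M N : List (Piece n)} → M ↭ N → pieceValue M ≡ pieceValue N
pieceValue-↭ {M = M} {N} σ = value-↭ (fromList (allLines M)) (fromList (allLines N))
  (subst₂ _↭_ (sym (Vec.toList∘fromList _)) (sym (Vec.toList∘fromList _)) (allLines-↭ σ))

∈-allLines⁻ : ∀ (N : List (Piece n)) {s} → s ∈ allLines N → ∃[ P ] ∃[ M ] N ↭ P ∷ M × s ∈ linesOf P
∈-allLines⁻ (P ∷ N) s∈ with Mem.∈-++⁻ (linesOf P) s∈
... | inj₁ s∈P = P , N , ↭-refl , s∈P
... | inj₂ s∈N with ∈-allLines⁻ N s∈N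
...   | Q , M , σ , s∈Q = Q , P ∷ M , ↭-trans (↭.prep P σ) (↭.swap P Q ↭-refl) , s∈Q

pieceValue-attained : ∀ (P₀ : Piece n) N₀ → Proper (P₀ ∷ N₀) →
  ∃[ P ] ∃[ N ] P₀ ∷ N₀ ↭ P ∷ N × pieceValue (P₀ ∷ N₀) ≡ openValue (shape P) (pieceValue N)
pieceValue-attained P₀ N₀ proper with bestMove _ _
... | claim s Ms σ s⊈ _ = ⊥-elim (s⊈ (quiet (P₀ ∷ N₀) proper σ))
... | pass s Ms σ s⊆ ζ≡ with ∈-allLines⁻ (P₀ ∷ N₀) (↭.∈-resp-↭ (↭-sym σ) (here refl))
...   | P , N , τ , s∈P = P , N , τ , trans (pieceValue-↭ τ) (ℤ.≤-antisym
  (pieceValue-≤ P N (Proper-↭ τ proper))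
  (pieceValue-≥ P N (Proper-↭ τ proper) s∈P (↭-trans (↭-sym (allLines-↭ τ)) σ)
    (trans (sym (ζ-↭ (allLines-↭ τ))) ζ≡)))

shape-matching : ∀ {X Xs} (N : List (Piece n)) → map shape N ↭ X ∷ Xs →
  ∃[ P ] ∃[ M ] N ↭ P ∷ M × shape P ≡ X × map shape M ↭ Xs
shape-matching N σ with Mem.∈-map⁻ shape (↭.∈-resp-↭ (↭-sym σ) (here refl))
... | P , P∈N , refl with ∈⇒↭ P∈N
...   | M , τ = P , M , τ , refl , ↭.drop-∷ (↭-trans (↭-sym (↭.map⁺ shape τ)) σ)

-- The best opening of `N` is matched by a piece of `M` of the same shape, and by induction the two
-- rests, whose shapes agree, have equal values. So boxes need not be identified, even when `M` and
-- `N` lie over different box sets.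
pieceValue-shape : ∀ k (M : List (Piece m)) (N : List (Piece n)) → length N ≡ k → Proper M → Proper N →
  map shape M ↭ map shape N → pieceValue M ≤ pieceValue N
pieceValue-shape zero    []      []      _  pM pN σ = ℤ.≤-refl
pieceValue-shape zero    (_ ∷ _) []      _  pM pN σ = contradiction σ ↭.¬x∷xs↭[]
pieceValue-shape (suc k) M       (Q₀ ∷ N₀) eq pM pN σ with pieceValue-attained Q₀ N₀ pN
... | Q , N , τ , value≡ with shape-matching M (↭-trans σ (↭.map⁺ shape τ))
...   | P , M′ , υ , shape≡ , σ′ rewrite value≡ | pieceValue-↭ υ | sym shape≡ =
  ℤ.≤-trans (pieceValue-≤ P M′ (Proper-↭ υ pM))
    (ℤ.≤-reflexive (cong (openValue (shape P)) (ℤ.≤-antisym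
      (pieceValue-shape k M′ N lenN pM′ pN′ σ′)
      (pieceValue-shape k N M′ (trans lenM lenN) pN′ pM′ (↭-sym σ′)))))
  where
  pM′ = Proper-tail (Proper-↭ υ pM)
  pN′ = Proper-tail (Proper-↭ τ pN)
  lenN : length N ≡ k
  lenN = ℕ.suc-injective (trans (sym (↭.↭-length τ)) eq)
  lenM : length M′ ≡ length N
  lenM = trans (sym (List.length-map shape M′)) (trans (↭.↭-length σ′) (List.length-map shape N))

-- Positions built from chains and loops as lists of pieces

record Embedding (n m : ℕ) : Set where
  field
    box       : Fin n → Fin m
    -- On lines this is padding by `⊥`, as in `_⊎_`, and not an image under `box`; the last three
    -- laws tie the two together.
    set       : Subset n → Subset m
    injective : ∀ {i j} → box i ≡ box j → i ≡ j
    set-⊥     : set ⊥ ≡ ⊥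
    set-∪     : ∀ p q → set (p ∪ q) ≡ set p ∪ set q
    set-⁅⁆    : ∀ i → set ⁅ i ⁆ ≡ ⁅ box i ⁆

  piece : Piece n → Piece m
  piece (string bs) = string (map box bs)
  piece (ring x bs) = ring (box x) (map box bs)

  anchor-piece : ∀ P → anchor (piece P) ≡ set (anchor P)
  anchor-piece (string _) = sym set-⊥
  anchor-piece (ring x _) = sym (set-⁅⁆ x)

  interior-piece : ∀ P → interior (piece P) ≡ map box (interior P)
  interior-piece (string _) = refl
  interior-piece (ring _ _) = refl

  boxesOf-piece : ∀ P → boxesOf (piece P) ≡ map box (boxesOf P)
  boxesOf-piece (string _) = refl
  boxesOf-piece (ring _ _) = refl

  shape-piece : ∀ P → shape (piece P) ≡ shape P
  shape-piece (string bs) = cong chainOf (List.length-map box bs)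
  shape-piece (ring _ bs) = cong (λ k → loopOf (suc k)) (List.length-map box bs)

  edge-set : ∀ y z bs → edge (set y) (set z) (map box bs) ≡ set (edge y z bs)
  edge-set y z []       = sym (set-∪ y z)
  edge-set y z (b ∷ bs) = sym (trans (set-∪ y ⁅ b ⁆) (cong (set y ∪_) (set-⁅⁆ b)))

  half-set : ∀ z bs → half (set z) (map box bs) ≡ map set (half z bs)
  half-set z []       = refl
  half-set z (b ∷ bs) = cong₂ _∷_
    (trans (cong (λ y → edge y (set z) (map box bs)) (sym (set-⁅⁆ b))) (edge-set ⁅ b ⁆ z bs))
    (half-set z bs)

  linesOf-piece : ∀ P → linesOf (piece P) ≡ map set (linesOf P)
  linesOf-piece P rewrite anchor-piece P | interior-piece P =
    cong₂ _∷_ (edge-set (anchor P) (anchor P) (interior P)) (half-set (anchor P) (interior P))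

  allLines-piece : ∀ N → allLines (map piece N) ≡ map set (allLines N)
  allLines-piece []      = refl
  allLines-piece (P ∷ N) = trans (cong₂ _++_ (linesOf-piece P) (allLines-piece N))
    (sym (List.map-++ set (linesOf P) (allLines N)))

  allBoxes-piece : ∀ N → allBoxes (map piece N) ≡ map box (allBoxes N)
  allBoxes-piece []      = refl
  allBoxes-piece (P ∷ N) = trans (cong₂ _++_ (boxesOf-piece P) (allBoxes-piece N))
    (sym (List.map-++ box (boxesOf P) (allBoxes N)))

  shapes-piece : ∀ N → map shape (map piece N) ≡ map shape N
  shapes-piece []      = refl
  shapes-piece (P ∷ N) = cong₂ _∷_ (shape-piece P) (shapes-piece N)

⊥++⊥ : ∀ n → ⊥ {n} Vec.++ ⊥ {m} ≡ ⊥
⊥++⊥ zero    = refl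
⊥++⊥ (suc n) = cong (outside ∷_) (⊥++⊥ n)

embedˡ : ∀ n m → Embedding n (n ℕ.+ m)
embedˡ n m = record
  { box       = _↑ˡ m
  ; set       = Vec._++ ⊥
  ; injective = Fin.↑ˡ-injective m _ _
  ; set-⊥     = ⊥++⊥ n
  ; set-∪     = λ p q → trans (cong ((p ∪ q) Vec.++_) (sym (Subset.∪-identityˡ ⊥)))
                  (sym (Vec.zipWith-++ _∨_ p ⊥ q ⊥))
  ; set-⁅⁆    = singleton
  }
  where
  singleton : ∀ {n} (i : Fin n) → ⁅ i ⁆ Vec.++ ⊥ {m} ≡ ⁅ i ↑ˡ m ⁆
  singleton {suc n} zero    = cong (inside ∷_) (⊥++⊥ n)
  singleton         (suc i) = cong (outside ∷_) (singleton i)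

embedʳ : ∀ n m → Embedding m (n ℕ.+ m)
embedʳ n m = record
  { box       = n ↑ʳ_
  ; set       = ⊥ Vec.++_
  ; injective = Fin.↑ʳ-injective n _ _
  ; set-⊥     = ⊥++⊥ n
  ; set-∪     = λ p q → trans (cong (Vec._++ (p ∪ q)) (sym (Subset.∪-identityˡ ⊥)))
                  (sym (Vec.zipWith-++ _∨_ ⊥ p ⊥ q))
  ; set-⁅⁆    = singleton n
  }
  where
  singleton : ∀ n (i : Fin m) → ⊥ {n} Vec.++ ⁅ i ⁆ ≡ ⁅ n ↑ʳ i ⁆
  singleton zero    i = refl
  singleton (suc n) i = cong (outside ∷_) (singleton n i)

record Realises (H : Position) (Xs : List Component) : Set where
  field
    pieces : List (Piece (boxes H))
    lines≡ : toList (lines H) ≡ allLines pieces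
    unique : Unique (allBoxes pieces)
    shapes : map shape pieces ≡ Xs

open Realises

realises-∅ : Realises ∅ []
realises-∅ = record { pieces = [] ; lines≡ = refl ; unique = [] ; shapes = refl }

realises-⊎ : ∀ {H K Xs Ys} → Realises H Xs → Realises K Ys → Realises (H ⊎ K) (Xs ++ Ys)
realises-⊎ {H} {K} rH rK = record
  { pieces = map E.piece (pieces rH) ++ map F.piece (pieces rK)
  ; lines≡ = trans (Vec.toList-++ (Vec.map E.set (lines H)) (Vec.map F.set (lines K)))
      (trans (cong₂ _++_
        (trans (Vec.toList-map E.set (lines H)) (trans (cong (map E.set) (lines≡ rH)) (sym (E.allLines-piece (pieces rH)))))
        (trans (Vec.toList-map F.set (lines K)) (trans (cong (map F.set) (lines≡ rK)) (sym (F.allLines-piece (pieces rK))))))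
      (sym (List.concatMap-++ linesOf (map E.piece (pieces rH)) (map F.piece (pieces rK)))))
  ; unique = subst Unique
      (sym (trans (List.concatMap-++ boxesOf (map E.piece (pieces rH)) (map F.piece (pieces rK)))
        (cong₂ _++_ (E.allBoxes-piece (pieces rH)) (F.allBoxes-piece (pieces rK)))))
      (Unique.++⁺ (Unique.map⁺ E.injective (unique rH)) (Unique.map⁺ F.injective (unique rK)) disjoint)
  ; shapes = trans (List.map-++ shape (map E.piece (pieces rH)) (map F.piece (pieces rK)))
      (cong₂ _++_ (trans (E.shapes-piece (pieces rH)) (shapes rH)) (trans (F.shapes-piece (pieces rK)) (shapes rK)))
  }
  where
  module E = Embedding (embedˡ (boxes H) (boxes K))
  module F = Embedding (embedʳ (boxes H) (boxes K))
  disjoint : ∀ {i} → i ∈ map E.box (allBoxes (pieces rH)) × i ∈ map F.box (allBoxes (pieces rK)) → Empty.⊥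
  disjoint (i∈ , i∈′) with Mem.∈-map⁻ E.box i∈ | Mem.∈-map⁻ F.box i∈′
  ... | j , _ , refl | k , _ , eq with trans (sym (Fin.splitAt-↑ˡ (boxes H) j (boxes K)))
                                       (trans (cong (Fin.splitAt (boxes H)) eq) (Fin.splitAt-↑ʳ (boxes H) (boxes K) k))
  ...   | ()

-- A path is recognised from the left and right ends l i and r i of its i-th line.
tabulate-path : ∀ {m} n (L l r : Fin (suc n) → Subset m) (f : Fin n → Fin m) {z} →
  (∀ i → L i ≡ l i ∪ r i) → (∀ i → l (suc i) ≡ ⁅ f i ⁆) →
  (∀ i → r (inject₁ i) ≡ ⁅ f i ⁆) → r (fromℕ n) ≡ z →
  toList (tabulate L) ≡ edge (l zero) z (List.tabulate f) ∷ half z (List.tabulate f)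
tabulate-path zero    L l r f L≡ l≡ r≡ refl = cong (_∷ []) (L≡ zero)
tabulate-path (suc n) L l r f {z} L≡ l≡ r≡ last≡ = cong₂ _∷_
  (trans (L≡ zero) (cong (l zero ∪_) (r≡ zero)))
  (trans (tabulate-path n (λ i → L (suc i)) (λ i → l (suc i)) (λ i → r (suc i)) (λ i → f (suc i))
            (λ i → L≡ (suc i)) (λ i → l≡ (suc i)) (λ i → r≡ (suc i)) last≡)
    (cong (λ y → edge y z (List.tabulate λ i → f (suc i)) ∷ half z (List.tabulate λ i → f (suc i))) (l≡ zero)))

tabulate-⊥ : (f : Fin n → Bool) → (∀ j → f j ≡ false) → tabulate f ≡ ⊥
tabulate-⊥ {zero}  f out = refl
tabulate-⊥ {suc n} f out = cong₂ _∷_ (out zero) (tabulate-⊥ (λ j → f (suc j)) (λ j → out (suc j)))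

tabulate-⁅⁆ : ∀ (i : Fin n) (f : Fin n → Bool) → f i ≡ true → (∀ j → j ≢ i → f j ≡ false) →
  tabulate f ≡ ⁅ i ⁆
tabulate-⁅⁆ zero    f in′ out = cong₂ _∷_ in′ (tabulate-⊥ (λ j → f (suc j)) (λ j → out (suc j) λ ()))
tabulate-⁅⁆ (suc i) f in′ out = cong₂ _∷_ (out zero λ ())
  (tabulate-⁅⁆ i (λ j → f (suc j)) in′ (λ j j≢i → out (suc j) λ eq → j≢i (Fin.suc-injective eq)))

tabulate-∪ : (f g : Fin n → Bool) → tabulate (λ j → f j ∨ g j) ≡ tabulate f ∪ tabulate g
tabulate-∪ {zero}  f g = refl
tabulate-∪ {suc n} f g = cong ((f zero ∨ g zero) ∷_) (tabulate-∪ (λ j → f (suc j)) (λ j → g (suc j)))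

realises-chain : ∀ n → Realises (chain n) (chainOf n ∷ [])
realises-chain n = record
  { pieces = string (allFin n) ∷ []
  ; lines≡ = trans
      (tabulate-path n _ l r (λ i → i) (λ i → trans (tabulate-∪ _ _) (Subset.∪-comm (r i) (l i))) l-suc r-inject₁ r-last)
      (trans (cong (λ y → edge y ⊥ (allFin n) ∷ half ⊥ (allFin n)) (tabulate-⊥ _ λ j → refl)) (sym (List.++-identityʳ _)))
  ; unique = subst Unique (sym (List.++-identityʳ _)) (Unique.allFin⁺ n)
  ; shapes = cong (λ k → chainOf k ∷ []) (List.length-tabulate {n = n} λ i → i)
  }
  where
  l r : Fin (suc n) → Subset n
  l i = tabulate λ j → does (toℕ i ℕ.≟ suc (toℕ j))
  r i = tabulate λ j → does (toℕ i ℕ.≟ toℕ j)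
  l-suc : ∀ i → l (suc i) ≡ ⁅ i ⁆
  l-suc i = tabulate-⁅⁆ i _ (dec-true (suc (toℕ i) ℕ.≟ _) refl)
    (λ j j≢i → dec-false (_ ℕ.≟ _) λ eq → j≢i (Fin.toℕ-injective (sym (ℕ.suc-injective eq))))
  r-inject₁ : ∀ i → r (inject₁ i) ≡ ⁅ i ⁆
  r-inject₁ i = tabulate-⁅⁆ i _ (dec-true (_ ℕ.≟ _) (Fin.toℕ-inject₁ i))
    (λ j j≢i → dec-false (_ ℕ.≟ _) λ eq → j≢i (Fin.toℕ-injective (trans (sym eq) (Fin.toℕ-inject₁ i))))
  r-last : r (fromℕ n) ≡ ⊥
  r-last = tabulate-⊥ _ λ j → dec-false (_ ℕ.≟ _) λ eq →
    ℕ.<⇒≢ (Fin.toℕ<n j) (trans (sym eq) (Fin.toℕ-fromℕ n))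

realises-loop : ∀ n → Realises (loop (suc n)) (loopOf (suc n) ∷ [])
realises-loop n = record
  -- The cut is at box 0, the only box at which the successor wraps round.
  { pieces = ring zero (List.tabulate suc) ∷ []
  ; lines≡ = trans (tabulate-path n _ ⁅_⁆ (λ i → ⁅ suc (toℕ i) mod suc n ⁆) suc (λ i → refl) (λ i → refl)
        (λ i → cong ⁅_⁆ (next i)) (cong ⁅_⁆ next-last))
      (sym (List.++-identityʳ _))
  ; unique = subst Unique (sym (List.++-identityʳ _)) (Unique.allFin⁺ (suc n))
  ; shapes = cong (λ k → loopOf (suc k) ∷ []) (List.length-tabulate {n = n} suc)
  }
  where
  toℕ-mod : ∀ k → toℕ (k mod suc n) ≡ k % suc n
  toℕ-mod k = Fin.toℕ-fromℕ< _
  next : ∀ i → suc (toℕ (inject₁ i)) mod suc n ≡ suc i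
  next i = Fin.toℕ-injective (trans (toℕ-mod (suc (toℕ (inject₁ i))))
    (trans (m<n⇒m%n≡m (s≤s (ℕ.≤-trans (ℕ.≤-reflexive (cong suc (Fin.toℕ-inject₁ i))) (Fin.toℕ<n i))))
      (cong suc (Fin.toℕ-inject₁ i))))
  next-last : suc (toℕ (fromℕ n)) mod suc n ≡ zero
  next-last = Fin.toℕ-injective (trans (toℕ-mod (suc (toℕ (fromℕ n))))
    (trans (cong (λ k → suc k % suc n) (Fin.toℕ-fromℕ n)) (n%n≡0 (suc n))))

realises-union : ∀ {A : Set} (f : A → Position) (g : A → Component) (xs : List A) →
  (∀ {x} → x ∈ xs → Realises (f x) (g x ∷ [])) →
  Realises (List.foldr _⊎_ ∅ (map f xs)) (map g xs)
realises-union f g []       _ = realises-∅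
realises-union f g (x ∷ xs) r = realises-⊎ (r (here refl)) (realises-union f g xs (λ x∈ → r (there x∈)))

-- Endgames with one component removed

components : SimpleLoonyEndgame → List Component
components G = map chainOf (chains G) ++ map loopOf (loops G)

realises-toPosition : ∀ G → Realises (toPosition G) (components G)
realises-toPosition G = realises-⊎ (realises-union chain chainOf (chains G) (λ {n} _ → realises-chain n))
  (realises-union loop loopOf (loops G) (λ ℓ∈ → loop⁺ (All.lookup (loopsOK G) ℓ∈)))
  where
  loop⁺ : ∀ {ℓ} {B : Set} → 4 ℕ.≤ ℓ × B → Realises (loop ℓ) (loopOf ℓ ∷ [])
  loop⁺ {suc ℓ} _ = realises-loop ℓ

piecesOf : (G : SimpleLoonyEndgame) → List (Piece (boxes (toPosition G)))
piecesOf G = pieces (realises-toPosition G)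

shapesOf : ∀ G → map shape (piecesOf G) ≡ components G
shapesOf G = shapes (realises-toPosition G)

v-pieces : ∀ G → v G ≡ pieceValue (piecesOf G)
v-pieces G = value-↭ (lines (toPosition G)) (fromList (allLines (piecesOf G)))
  (↭-reflexive (trans (lines≡ (realises-toPosition G)) (sym (Vec.toList∘fromList _))))

proper-piecesOf : ∀ G → Proper (piecesOf G)
proper-piecesOf G = unique (realises-toPosition G) , All.map⁻ (subst (All LongComponent) (sym (shapesOf G))
  (All.++⁺ (All.map⁺ (chains≥3 G)) (All.map⁺ (All.map proj₁ (loopsOK G)))))

v-↭ : ∀ G H → components G ↭ components H → v G ≡ v H
v-↭ G H σ = trans (v-pieces G) (trans (ℤ.≤-antisym
    (pieceValue-shape _ (piecesOf G) (piecesOf H) refl (proper-piecesOf G) (proper-piecesOf H) τ)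
    (pieceValue-shape _ (piecesOf H) (piecesOf G) refl (proper-piecesOf H) (proper-piecesOf G) (↭-sym τ)))
  (sym (v-pieces H)))
  where
  τ = subst₂ _↭_ (sym (shapesOf G)) (sym (shapesOf H)) σ

v-open-≤ : ∀ G H X → components G ↭ X ∷ components H → v G ≤ openValue X (v H)
v-open-≤ G H X σ with shape-matching (piecesOf G) (↭-trans (↭-reflexive (shapesOf G)) σ)
... | P , M , τ , refl , τ′ = subst₂ (λ y x → y ≤ openValue (shape P) x)
  (sym (trans (v-pieces G) (pieceValue-↭ τ))) (sym vH) (pieceValue-≤ P M (Proper-↭ τ (proper-piecesOf G)))
  where
  pM = Proper-tail (Proper-↭ τ (proper-piecesOf G))
  τH = ↭-trans τ′ (↭-reflexive (sym (shapesOf H)))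
  vH : v H ≡ pieceValue M
  vH = trans (v-pieces H) (ℤ.≤-antisym
    (pieceValue-shape _ (piecesOf H) M refl (proper-piecesOf H) pM (↭-sym τH))
    (pieceValue-shape _ M (piecesOf H) refl pM (proper-piecesOf H) τH))

─-↭ : ∀ {x : ℕ} {xs} (x∈ : x ∈ xs) → xs ↭ x ∷ (xs Any.─ x∈)
─-↭ (here refl) = ↭-refl
─-↭ {x} (there {x = y} x∈) = ↭-trans (↭.prep y (─-↭ x∈)) (↭.swap y x ↭-refl)

components-∖chain : ∀ G {n} (n∈ : n ∈ chains G) → components G ↭ chainOf n ∷ components (G ∖chain n∈)
components-∖chain G n∈ = ↭.++⁺ʳ (map loopOf (loops G)) (↭.map⁺ chainOf (─-↭ n∈))

components-∖loop : ∀ G {ℓ} (ℓ∈ : ℓ ∈ loops G) → components G ↭ loopOf ℓ ∷ components (G ∖loop ℓ∈)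
components-∖loop G ℓ∈ = ↭-trans (↭.++⁺ˡ (map chainOf (chains G)) (↭.map⁺ loopOf (─-↭ ℓ∈)))
  (↭.shift _ (map chainOf (chains G)) _)

v-≤-chain : ∀ G {n} (n∈ : n ∈ chains G) → v G ≤ openValue (chainOf n) (v (G ∖chain n∈))
v-≤-chain G n∈ = v-open-≤ G (G ∖chain n∈) _ (components-∖chain G n∈)

v-≤-loop : ∀ G {ℓ} (ℓ∈ : ℓ ∈ loops G) → v G ≤ openValue (loopOf ℓ) (v (G ∖loop ℓ∈))
v-≤-loop G ℓ∈ = v-open-≤ G (G ∖loop ℓ∈) _ (components-∖loop G ℓ∈)

data BestOpening (G : SimpleLoonyEndgame) : Set where
  empty     : components G ≡ [] → v G ≡ + 0 → BestOpening G
  openChain : ∀ {n} (n∈ : n ∈ chains G) → v G ≡ openValue (chainOf n) (v (G ∖chain n∈)) → BestOpening G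
  openLoop  : ∀ {ℓ} (ℓ∈ : ℓ ∈ loops G) → v G ≡ openValue (loopOf ℓ) (v (G ∖loop ℓ∈)) → BestOpening G

bestOpening : ∀ G → BestOpening G
bestOpening G = go (piecesOf G) (proper-piecesOf G) (shapesOf G) (v-pieces G)
  where
  go : ∀ {n} (N : List (Piece n)) → Proper N → map shape N ≡ components G → v G ≡ pieceValue N → BestOpening G
  go []      pN shapes≡ v≡ = empty (sym shapes≡) v≡
  go (P₀ ∷ N₀) pN shapes≡ v≡ with pieceValue-attained P₀ N₀ pN
  ... | P , N , τ , value≡ = which (shape P) (↭-trans (↭-reflexive (sym shapes≡)) (↭.map⁺ shape τ)) (trans v≡ value≡)
    where
    pN′ = Proper-tail (Proper-↭ τ pN)
    v-rest : ∀ H {X} → components G ↭ X ∷ components H → components G ↭ X ∷ map shape N → pieceValue N ≡ v H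
    v-rest H σ σ′ = trans (ℤ.≤-antisym
        (pieceValue-shape _ N (piecesOf H) refl pN′ (proper-piecesOf H) ρ)
        (pieceValue-shape _ (piecesOf H) N refl (proper-piecesOf H) pN′ (↭-sym ρ)))
      (sym (v-pieces H))
      where
      ρ : map shape N ↭ map shape (piecesOf H)
      ρ = ↭-trans (↭.drop-∷ (↭-trans (↭-sym σ′) σ)) (↭-reflexive (sym (shapesOf H)))
    which : ∀ X → components G ↭ X ∷ map shape N → v G ≡ openValue X (pieceValue N) → BestOpening G
    which X σ v≡ with Mem.∈-++⁻ (map chainOf (chains G)) (↭.∈-resp-↭ (↭-sym σ) (here refl))
    ... | inj₁ X∈ with Mem.∈-map⁻ chainOf X∈
    ...   | n , n∈ , refl = openChain n∈ (trans v≡ (cong (openValue X) (v-rest (G ∖chain n∈) (components-∖chain G n∈) σ)))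
    which X σ v≡ | inj₂ X∈ with Mem.∈-map⁻ loopOf X∈
    ...   | ℓ , ℓ∈ , refl = openLoop ℓ∈ (trans v≡ (cong (openValue X) (v-rest (G ∖loop ℓ∈) (components-∖loop G ℓ∈) σ)))

-- The lower bound by controlled value, and parity

-- This is cv G if G has a chain of length at least 4.
κ : SimpleLoonyEndgame → ℤ
κ G = fcv G + + 4

count : SimpleLoonyEndgame → ℕ
count G = length (chains G) ℕ.+ length (loops G)

length-─ : ∀ {x : ℕ} {xs} (x∈ : x ∈ xs) → length xs ≡ suc (length (xs Any.─ x∈))
length-─ x∈ = ↭.↭-length (─-↭ x∈)

count-∖chain : ∀ G {n k} (n∈ : n ∈ chains G) → count G ≡ suc k → count (G ∖chain n∈) ≡ k
count-∖chain G n∈ eq = ℕ.suc-injective (trans (cong (ℕ._+ length (loops G)) (sym (length-─ n∈))) eq)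

count-∖loop : ∀ G {ℓ k} (ℓ∈ : ℓ ∈ loops G) → count G ≡ suc k → count (G ∖loop ℓ∈) ≡ k
count-∖loop G ℓ∈ eq = ℕ.suc-injective (trans (sym (ℕ.+-suc (length (chains G)) _))
  (trans (cong (length (chains G) ℕ.+_) (sym (length-─ ℓ∈))) eq))

chain⇒count≢0 : ∀ G {n} → n ∈ chains G → count G ≢ 0
chain⇒count≢0 (endgame (_ ∷ _) _ _ _) _ ()

loop⇒count≢0 : ∀ G {ℓ} → ℓ ∈ loops G → count G ≢ 0
loop⇒count≢0 (endgame cs (_ ∷ _) _ _) _ eq with trans (sym (ℕ.+-suc (length cs) _)) eq
... | ()

∑-─ : ∀ (f : ℕ → ℤ) {x xs} (x∈ : x ∈ xs) → ∑ (map f xs) ≡ f x + ∑ (map f (xs Any.─ x∈))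
∑-─ f (here refl) = refl
∑-─ f {x} (there {x = y} x∈) = trans (cong (λ s → f y + s) (∑-─ f x∈)) (lemma (f x) (f y) _)
  where
  lemma : ∀ a b c → b + (a + c) ≡ a + (b + c)
  lemma = solve-∀

κ-∖chain : ∀ G {n} (n∈ : n ∈ chains G) → κ (G ∖chain n∈) ≡ κ G + (+ 4 - + n)
κ-∖chain G {n} n∈ = trans
  (lemma (+ n) (∑ (map (λ c → + c - + 4) (chains G Any.─ n∈))) (∑ (map (λ ℓ → + ℓ - + 8) (loops G))))
  (cong (λ s → s + ∑ (map (λ ℓ → + ℓ - + 8) (loops G)) + + 4 + (+ 4 - + n)) (sym (∑-─ (λ c → + c - + 4) n∈)))
  where
  lemma : ∀ n a b → a + b + + 4 ≡ n - + 4 + a + b + + 4 + (+ 4 - n)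
  lemma = solve-∀

κ-∖loop : ∀ G {ℓ} (ℓ∈ : ℓ ∈ loops G) → κ (G ∖loop ℓ∈) ≡ κ G + (+ 8 - + ℓ)
κ-∖loop G {ℓ} ℓ∈ = trans
  (lemma (+ ℓ) (∑ (map (λ c → + c - + 4) (chains G))) (∑ (map (λ ℓ → + ℓ - + 8) (loops G Any.─ ℓ∈))))
  (cong (λ s → ∑ (map (λ c → + c - + 4) (chains G)) + s + + 4 + (+ 8 - + ℓ)) (sym (∑-─ (λ ℓ → + ℓ - + 8) ℓ∈)))
  where
  lemma : ∀ ℓ a b → a + b + + 4 ≡ a + (ℓ - + 8 + b) + + 4 + (+ 8 - ℓ)
  lemma = solve-∀

openChain-≥ : ∀ {n} x → 3 ℕ.≤ n → + 1 ≤ openValue (chainOf n) x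
openChain-≥ {n} x 3≤ = ≤-by-difference (ℤ.+-mono-≤ (+≤+ 3≤) (+≤+ (z≤n {∣ x - + 2 ∣}))) (lemma (+ n) (+ ∣ x - + 2 ∣))
  where
  lemma : ∀ n a → n - + 2 + a - + 1 ≡ n + a - (+ 3 + + 0)
  lemma = solve-∀

openLongChain-≥ : ∀ {n} x → 4 ℕ.≤ n → + 2 ≤ openValue (chainOf n) x
openLongChain-≥ {n} x 4≤ = ≤-by-difference (ℤ.+-mono-≤ (+≤+ 4≤) (+≤+ (z≤n {∣ x - + 2 ∣}))) (lemma (+ n) (+ ∣ x - + 2 ∣))
  where
  lemma : ∀ n a → n - + 2 + a - + 2 ≡ n + a - (+ 4 + + 0)
  lemma = solve-∀

openLoop-≥ : ∀ {ℓ} x → 4 ℕ.≤ ℓ → + 0 ≤ openValue (loopOf ℓ) x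
openLoop-≥ {ℓ} x 4≤ = ≤-by-difference (ℤ.+-mono-≤ (+≤+ 4≤) (+≤+ (z≤n {∣ x - + 4 ∣}))) (lemma (+ ℓ) (+ ∣ x - + 4 ∣))
  where
  lemma : ∀ n a → n - + 4 + a - + 0 ≡ n + a - (+ 4 + + 0)
  lemma = solve-∀

openLongLoop-≥ : ∀ {ℓ} x → 6 ℕ.≤ ℓ → + 2 ≤ openValue (loopOf ℓ) x
openLongLoop-≥ {ℓ} x 6≤ = ≤-by-difference (ℤ.+-mono-≤ (+≤+ 6≤) (+≤+ (z≤n {∣ x - + 4 ∣}))) (lemma (+ ℓ) (+ ∣ x - + 4 ∣))
  where
  lemma : ∀ n a → n - + 4 + a - + 2 ≡ n + a - (+ 6 + + 0)
  lemma = solve-∀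

v-nonNegative : ∀ G → + 0 ≤ v G
v-nonNegative G = cases (bestOpening G)
  where
  cases : BestOpening G → + 0 ≤ v G
  cases (empty _ v≡)      = ℤ.≤-reflexive (sym v≡)
  cases (openChain n∈ v≡) = subst (+ 0 ≤_) (sym v≡)
    (ℤ.≤-trans (+≤+ z≤n) (openChain-≥ (v (G ∖chain n∈)) (All.lookup (chains≥3 G) n∈)))
  cases (openLoop ℓ∈ v≡)  = subst (+ 0 ≤_) (sym v≡)
    (openLoop-≥ (v (G ∖loop ℓ∈)) (proj₁ (All.lookup (loopsOK G) ℓ∈)))

empty⇒κ≡4 : ∀ G → components G ≡ [] → κ G ≡ + 4
empty⇒κ≡4 (endgame [] [] _ _) _ = refl

components≡[]⇒count≡0 : ∀ G → components G ≡ [] → count G ≡ 0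
components≡[]⇒count≡0 (endgame [] [] _ _) _ = refl

-- Since |x - 2| is at least x - 2, keeping control loses nothing against `κ`. The second
-- alternative is the empty rest: its value 0 is below its `κ` of 4, but |0 - 2| makes up for this.
-- `loop-bound` is the same with 4 in place of 2.
chain-bound : ∀ n {k i x} → i ≡ k + (+ 4 - + n) → i ≤ x or (x ≡ + 0 × i ≡ + 4) → k ≤ openValue (chainOf n) x
chain-bound n {k} {x = x} refl (inj₁ i≤x) = ≤-by-difference (ℤ.+-mono-≤ i≤x (i≤∣i∣ (x - + 2)))
  (lemma k (+ n) x (+ ∣ x - + 2 ∣))
  where
  lemma : ∀ k n x a → n - + 2 + a - k ≡ x + a - (k + (+ 4 - n) + (x - + 2))
  lemma = solve-∀
chain-bound n {k} refl (inj₂ (refl , i≡4)) = ≤-by-difference (ℤ.≤-reflexive i≡4) (lemma k (+ n))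
  where
  lemma : ∀ k n → n - + 2 + + 2 - k ≡ + 4 - (k + (+ 4 - n))
  lemma = solve-∀

loop-bound : ∀ ℓ {k i x} → i ≡ k + (+ 8 - + ℓ) → i ≤ x or (x ≡ + 0 × i ≡ + 4) → k ≤ openValue (loopOf ℓ) x
loop-bound ℓ {k} {x = x} refl (inj₁ i≤x) = ≤-by-difference (ℤ.+-mono-≤ i≤x (i≤∣i∣ (x - + 4)))
  (lemma k (+ ℓ) x (+ ∣ x - + 4 ∣))
  where
  lemma : ∀ k n x a → n - + 4 + a - k ≡ x + a - (k + (+ 8 - n) + (x - + 4))
  lemma = solve-∀
loop-bound ℓ {k} refl (inj₂ (refl , i≡4)) = ≤-by-difference
  (ℤ.≤-trans (ℤ.≤-reflexive i≡4) (+≤+ (ℕ.m≤n+m 4 4))) (lemma k (+ ℓ))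
  where
  lemma : ∀ k n → n - + 4 + + 4 - k ≡ + 8 - (k + (+ 8 - n))
  lemma = solve-∀

-- In a nonempty endgame the controller obtains at least κ by always keeping control.
κ≤v-or-empty : ∀ k G → count G ≡ k → κ G ≤ v G or (count G ≡ 0 × v G ≡ + 0 × κ G ≡ + 4)
κ≤v-or-empty k G count≡ = cases k count≡ (bestOpening G)
  where
  cases : ∀ k → count G ≡ k → BestOpening G → κ G ≤ v G or (count G ≡ 0 × v G ≡ + 0 × κ G ≡ + 4)
  cases _       _      (empty eq v≡)     = inj₂ (components≡[]⇒count≡0 G eq , v≡ , empty⇒κ≡4 G eq)
  cases zero    count≡ (openChain n∈ _)  = contradiction count≡ (chain⇒count≢0 G n∈)
  cases zero    count≡ (openLoop ℓ∈ _)   = contradiction count≡ (loop⇒count≢0 G ℓ∈)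
  cases (suc k) count≡ (openChain {n} n∈ v≡) = inj₁ (subst (κ G ≤_) (sym v≡)
    (chain-bound n {x = v (G ∖chain n∈)} (κ-∖chain G n∈)
      (Sum.map₂ proj₂ (κ≤v-or-empty k (G ∖chain n∈) (count-∖chain G n∈ count≡)))))
  cases (suc k) count≡ (openLoop {ℓ} ℓ∈ v≡) = inj₁ (subst (κ G ≤_) (sym v≡)
    (loop-bound ℓ {x = v (G ∖loop ℓ∈)} (κ-∖loop G ℓ∈)
      (Sum.map₂ proj₂ (κ≤v-or-empty k (G ∖loop ℓ∈) (count-∖loop G ℓ∈ count≡)))))

κ≤v : ∀ G {n} → n ∈ chains G → κ G ≤ v G
κ≤v G n∈ = Sum.fromInj₁ (λ (count≡0 , _) → contradiction count≡0 (chain⇒count≢0 G n∈))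
  (κ≤v-or-empty _ G refl)

Even : ℤ → Set
Even i = ∃[ j ] i ≡ j + j

even-+ : ∀ {i j} → Even i → Even j → Even (i + j)
even-+ (a , refl) (b , refl) = a + b , lemma a b
  where
  lemma : ∀ a b → a + a + (b + b) ≡ a + b + (a + b)
  lemma = solve-∀

even-- : ∀ {i j} → Even i → Even j → Even (i - j)
even-- (a , refl) (b , refl) = a - b , lemma a b
  where
  lemma : ∀ a b → a + a - (b + b) ≡ a - b + (a - b)
  lemma = solve-∀

even⇒∣ : ∀ {i} → Even i → + 2 ∣ i
even⇒∣ (j , refl) = Signed.∣⇒∣ᵤ (Signed.divides j (lemma j))
  where
  lemma : ∀ j → j + j ≡ j * + 2
  lemma = solve-∀

∣⇒even : ∀ {i} → + 2 ∣ i → Even i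
∣⇒even {i} 2∣i with Signed.∣ᵤ⇒∣ {+ 2} {i} 2∣i
... | Signed.divides j eq = j , trans eq (lemma j)
  where
  lemma : ∀ j → j * + 2 ≡ j + j
  lemma = solve-∀

even-∣-∣ : ∀ i → Even (+ ∣ i ∣ - i)
even-∣-∣ i with ℤ.+∣i∣≡i⊎+∣i∣≡-i i
... | inj₁ eq rewrite eq = + 0 , ℤ.+-inverseʳ i
... | inj₂ eq rewrite eq = - i , refl

chain-even : ∀ n {k i x} → i ≡ k + (+ 4 - + n) → Even (x - i) → Even (openValue (chainOf n) x - k)
chain-even n {k} {x = x} refl e = subst Even (lemma k (+ n) x (+ ∣ x - + 2 ∣)) (even-+ e (even-∣-∣ (x - + 2)))
  where
  lemma : ∀ k n x a → x - (k + (+ 4 - n)) + (a - (x - + 2)) ≡ n - + 2 + a - k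
  lemma = solve-∀

loop-even : ∀ ℓ {k i x} → i ≡ k + (+ 8 - + ℓ) → Even (x - i) → Even (openValue (loopOf ℓ) x - k)
loop-even ℓ {k} {x = x} refl e = subst Even (lemma k (+ ℓ) x (+ ∣ x - + 4 ∣)) (even-+ e (even-∣-∣ (x - + 4)))
  where
  lemma : ∀ k n x a → x - (k + (+ 8 - n)) + (a - (x - + 4)) ≡ n - + 4 + a - k
  lemma = solve-∀

-- A number and its absolute value have the same parity, so adding a component changes `v` and `κ`
-- by amounts of equal parity. The induction starts from the difference -4 of the empty endgame.
v-κ-even : ∀ k G → count G ≡ k → Even (v G - κ G)
v-κ-even k G count≡ = cases k count≡ (bestOpening G)
  where
  cases : ∀ k → count G ≡ k → BestOpening G → Even (v G - κ G)
  cases _       _      (empty eq v≡)    = - + 2 , cong₂ _-_ v≡ (empty⇒κ≡4 G eq)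
  cases zero    count≡ (openChain n∈ _) = contradiction count≡ (chain⇒count≢0 G n∈)
  cases zero    count≡ (openLoop ℓ∈ _)  = contradiction count≡ (loop⇒count≢0 G ℓ∈)
  cases (suc k) count≡ (openChain {n} n∈ v≡) = subst (λ x → Even (x - κ G)) (sym v≡)
    (chain-even n {x = v (G ∖chain n∈)} (κ-∖chain G n∈) (v-κ-even k (G ∖chain n∈) (count-∖chain G n∈ count≡)))
  cases (suc k) count≡ (openLoop {ℓ} ℓ∈ v≡) = subst (λ x → Even (x - κ G)) (sym v≡)
    (loop-even ℓ {x = v (G ∖loop ℓ∈)} (κ-∖loop G ℓ∈) (v-κ-even k (G ∖loop ℓ∈) (count-∖loop G ℓ∈ count≡)))

κ-even⇒v-even : ∀ G → Even (κ G) → Even (v G)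
κ-even⇒v-even G e = subst Even (lemma (v G) (κ G)) (even-+ (v-κ-even _ G refl) e)
  where
  lemma : ∀ a b → a - b + b ≡ a
  lemma = solve-∀

v-even⇒κ-even : ∀ G → Even (v G) → Even (κ G)
v-even⇒κ-even G e = subst Even (lemma (v G) (κ G)) (even-- e (v-κ-even _ G refl))
  where
  lemma : ∀ a b → a - (a - b) ≡ b
  lemma = solve-∀

-- Endgames whose chains all have length at least 4

openChain-≡ : ∀ n {x} → + 2 ≤ x → openValue (chainOf n) x ≡ + n - + 4 + x
openChain-≡ n {x} 2≤x = trans (cong (λ a → + n - + 2 + a) (ℤ.0≤i⇒+∣i∣≡i (ℤ.i≤j⇒0≤j-i 2≤x))) (lemma (+ n) x)
  where
  lemma : ∀ n x → n - + 2 + (x - + 2) ≡ n - + 4 + x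
  lemma = solve-∀

openLoop-≡ : ∀ ℓ {x} → + 4 ≤ x → openValue (loopOf ℓ) x ≡ + ℓ - + 8 + x
openLoop-≡ ℓ {x} 4≤x = trans (cong (λ a → + ℓ - + 4 + a) (ℤ.0≤i⇒+∣i∣≡i (ℤ.i≤j⇒0≤j-i 4≤x))) (lemma (+ ℓ) x)
  where
  lemma : ∀ n x → n - + 4 + (x - + 4) ≡ n - + 8 + x
  lemma = solve-∀

openLoop-∖ : ∀ G {ℓ} (ℓ∈ : ℓ ∈ loops G) → + 4 ≤ κ (G ∖loop ℓ∈) → openValue (loopOf ℓ) (κ (G ∖loop ℓ∈)) ≡ κ G
openLoop-∖ G {ℓ} ℓ∈ 4≤κ = trans (openLoop-≡ ℓ 4≤κ) (trans (cong (λ i → + ℓ - + 8 + i) (κ-∖loop G ℓ∈)) (lemma (+ ℓ) (κ G)))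
  where
  lemma : ∀ n k → n - + 8 + (k + (+ 8 - n)) ≡ k
  lemma = solve-∀

openChain-∖ : ∀ G {n} (n∈ : n ∈ chains G) → + 2 ≤ κ (G ∖chain n∈) → openValue (chainOf n) (κ (G ∖chain n∈)) ≡ κ G
openChain-∖ G {n} n∈ 2≤κ = trans (openChain-≡ n 2≤κ) (trans (cong (λ i → + n - + 4 + i) (κ-∖chain G n∈)) (lemma (+ n) (κ G)))
  where
  lemma : ∀ n k → n - + 4 + (k + (+ 4 - n)) ≡ k
  lemma = solve-∀

loopCases : ∀ {ℓ} → 4 ℕ.≤ ℓ × 2 ℕ.∣ ℓ → ℓ ≡ 4 or (ℓ ≡ 6 or 8 ℕ.≤ ℓ)
loopCases {4} _ = inj₁ refl
loopCases {5} (_ , 2∣5) = contradiction 2∣5 (from-no (2 ℕ.∣? 5))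
loopCases {6} _ = inj₂ (inj₁ refl)
loopCases {7} (_ , 2∣7) = contradiction 2∣7 (from-no (2 ℕ.∣? 7))
loopCases {suc (suc (suc (suc (suc (suc (suc (suc ℓ)))))))} _ =
  inj₂ (inj₂ (s≤s (s≤s (s≤s (s≤s (s≤s (s≤s (s≤s (s≤s z≤n)))))))))
loopCases {0} (() , _)
loopCases {1} (s≤s () , _)
loopCases {2} (s≤s (s≤s ()) , _)
loopCases {3} (s≤s (s≤s (s≤s ())) , _)

∑-nonNegative : ∀ k {xs} → All (k ℕ.≤_) xs → + 0 ≤ ∑ (map (λ x → + x - + k) xs)
∑-nonNegative k []         = ℤ.≤-refl
∑-nonNegative k (k≤x ∷ ps) = ℤ.+-mono-≤ (ℤ.i≤j⇒0≤j-i (+≤+ k≤x)) (∑-nonNegative k ps)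

LongChains : SimpleLoonyEndgame → Set
LongChains G = All (4 ℕ.≤_) (chains G)

4≤κ : ∀ G → LongChains G → All (8 ℕ.≤_) (loops G) → + 4 ≤ κ G
4≤κ G long 8≤ = ℤ.+-monoˡ-≤ (+ 4) (ℤ.+-mono-≤ (∑-nonNegative 4 long) (∑-nonNegative 8 8≤))

noShortLoops : ∀ G → ¬ 4 ∈ loops G → ¬ 6 ∈ loops G → All (8 ℕ.≤_) (loops G)
noShortLoops G no4 no6 = All.tabulate λ ℓ∈ → long ℓ∈ (loopCases (All.lookup (loopsOK G) ℓ∈))
  where
  long : ∀ {ℓ} → ℓ ∈ loops G → ℓ ≡ 4 or (ℓ ≡ 6 or 8 ℕ.≤ ℓ) → 8 ℕ.≤ ℓ
  long ℓ∈ (inj₁ refl)        = contradiction ℓ∈ no4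
  long ℓ∈ (inj₂ (inj₁ refl)) = contradiction ℓ∈ no6
  long ℓ∈ (inj₂ (inj₂ 8≤))   = 8≤

-- It is enough to open a component whose rest has `κ` large enough to drop the absolute value;
-- `openLoop-∖` or `openChain-∖` then returns `κ G`. Removing a 4-loop or a 6-loop raises `κ` to at
-- least 6 or 4. If there are none, no component counts negatively and every rest has `κ` at least
-- 4. Loops go first so that a chain remains for the induction.
long-v≤κ : ∀ k G → count G ≡ k → LongChains G → ∀ {n} → n ∈ chains G → + 2 ≤ κ G → v G ≤ κ G
long-v≤κ zero    G count≡ long n∈ 2≤κ = contradiction count≡ (chain⇒count≢0 G n∈)
long-v≤κ (suc k) G count≡ long n∈ 2≤κ = go (4 ∈? loops G) (6 ∈? loops G)
  where
  viaLoop : ∀ {ℓ} (ℓ∈ : ℓ ∈ loops G) → + 4 ≤ κ (G ∖loop ℓ∈) → v G ≤ κ G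
  viaLoop {ℓ} ℓ∈ 4≤ = ℤ.≤-trans (v-≤-loop G ℓ∈) (ℤ.≤-reflexive (trans
    (cong (openValue (loopOf ℓ)) (ℤ.≤-antisym
      (long-v≤κ k (G ∖loop ℓ∈) (count-∖loop G ℓ∈ count≡) long n∈ (ℤ.≤-trans (+≤+ (s≤s (s≤s z≤n))) 4≤))
      (κ≤v (G ∖loop ℓ∈) n∈)))
    (openLoop-∖ G ℓ∈ 4≤)))
  viaChain : ∀ {n} (n∈ : n ∈ chains G) → All (8 ℕ.≤_) (loops G) → loops G ≡ [] → v G ≤ κ G
  viaChain {n} n∈ 8≤ no-loops = ℤ.≤-trans (v-≤-chain G n∈) (rest (chains (G ∖chain n∈)) refl)
    where
    H = G ∖chain n∈
    longH : LongChains H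
    longH = All.─⁺ n∈ long
    rest : ∀ cs → chains H ≡ cs → openValue (chainOf n) (v H) ≤ κ G
    -- For the empty rest |0 - 2| = |4 - 2|, so its value 0 acts like its `κ`, which is 4.
    rest [] eq = ℤ.≤-reflexive (trans (cong (openValue (chainOf n)) vH≡0) (trans (lemma (+ n))
      (trans (cong (λ i → + n - + 4 + i) (trans (sym κH≡4) (κ-∖chain G n∈))) (lemma′ (+ n) (κ G)))))
      where
      emptyH : components H ≡ []
      emptyH = cong₂ (λ cs ls → map chainOf cs ++ map loopOf ls) eq no-loops
      κH≡4 : κ H ≡ + 4
      κH≡4 = empty⇒κ≡4 H emptyH
      vH≡0 : v H ≡ + 0
      vH≡0 = noOpening (bestOpening H)
        where
        noOpening : BestOpening H → v H ≡ + 0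
        noOpening (empty _ v≡)     = v≡
        noOpening (openChain c∈ _) = contradiction (components≡[]⇒count≡0 H emptyH) (chain⇒count≢0 H c∈)
        noOpening (openLoop ℓ∈ _)  = contradiction (components≡[]⇒count≡0 H emptyH) (loop⇒count≢0 H ℓ∈)
      lemma : ∀ n → n - + 2 + + 2 ≡ n - + 4 + + 4
      lemma = solve-∀
      lemma′ : ∀ n k → n - + 4 + (k + (+ 4 - n)) ≡ k
      lemma′ = solve-∀
    rest (c ∷ cs) eq = ℤ.≤-reflexive (trans
      (cong (openValue (chainOf n)) (ℤ.≤-antisym (long-v≤κ k H (count-∖chain G n∈ count≡) longH c∈ 2≤κH) (κ≤v H c∈)))
      (openChain-∖ G n∈ 2≤κH))
      where
      c∈ : c ∈ chains H
      c∈ = subst (c ∈_) (sym eq) (here refl)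
      2≤κH : + 2 ≤ κ H
      2≤κH = ℤ.≤-trans (+≤+ (s≤s (s≤s z≤n))) (4≤κ H longH 8≤)
  go : Dec (4 ∈ loops G) → Dec (6 ∈ loops G) → v G ≤ κ G
  go (yes 4∈) _ = viaLoop 4∈ (ℤ.≤-trans
    (ℤ.≤-trans (+≤+ (s≤s (s≤s (s≤s (s≤s z≤n))))) (ℤ.+-monoˡ-≤ (+ 4) 2≤κ))
    (ℤ.≤-reflexive (sym (κ-∖loop G 4∈))))
  go _ (yes 6∈) = viaLoop 6∈ (ℤ.≤-trans (ℤ.+-monoˡ-≤ (+ 2) 2≤κ) (ℤ.≤-reflexive (sym (κ-∖loop G 6∈))))
  go (no 4∉) (no 6∉) = byLoops (loops G) refl
    where
    8≤ : All (8 ℕ.≤_) (loops G)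
    8≤ = noShortLoops G 4∉ 6∉
    byLoops : ∀ ls → loops G ≡ ls → v G ≤ κ G
    byLoops []       eq = viaChain n∈ 8≤ eq
    byLoops (ℓ ∷ ls) eq = viaLoop ℓ∈ (4≤κ (G ∖loop ℓ∈) long (All.─⁺ ℓ∈ 8≤))
      where
      ℓ∈ : ℓ ∈ loops G
      ℓ∈ = subst (ℓ ∈_) (sym eq) (here refl)

long-v≡κ : ∀ G → LongChains G → ∀ {n} → n ∈ chains G → + 2 ≤ κ G → v G ≡ κ G
long-v≡κ G long n∈ 2≤κ = ℤ.≤-antisym (long-v≤κ _ G refl long n∈ 2≤κ) (κ≤v G n∈)

data Openings (G : SimpleLoonyEndgame) : Set where
  openThree : (3∈ : 3 ∈ chains G) → v G ≡ + 1 + + ∣ v (G ∖chain 3∈) - + 2 ∣ → Openings G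
  openFour  : (4∈ : 4 ∈ loops G) → v G ≡ + ∣ v (G ∖loop 4∈) - + 4 ∣ → Openings G
  openOther : + 2 ≤ v G → Openings G

openings : ∀ G {n} → n ∈ chains G → Openings G
openings G n∈ = cases (bestOpening G)
  where
  byLength : ∀ {c} (c∈ : c ∈ chains G) → v G ≡ openValue (chainOf c) (v (G ∖chain c∈)) → Dec (c ≡ 3) → Openings G
  byLength c∈ v≡ (yes refl) = openThree c∈ v≡
  byLength c∈ v≡ (no c≢3)   = openOther (subst (+ 2 ≤_) (sym v≡) (openLongChain-≥ (v (G ∖chain c∈))
    (ℕ.≤∧≢⇒< (All.lookup (chains≥3 G) c∈) λ 3≡c → c≢3 (sym 3≡c))))
  atLeast6 : ∀ {ℓ} (ℓ∈ : ℓ ∈ loops G) → v G ≡ openValue (loopOf ℓ) (v (G ∖loop ℓ∈)) → 6 ℕ.≤ ℓ → Openings G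
  atLeast6 ℓ∈ v≡ 6≤ = openOther (subst (+ 2 ≤_) (sym v≡) (openLongLoop-≥ (v (G ∖loop ℓ∈)) 6≤))
  bySize : ∀ {ℓ} (ℓ∈ : ℓ ∈ loops G) → v G ≡ openValue (loopOf ℓ) (v (G ∖loop ℓ∈)) →
    ℓ ≡ 4 or (ℓ ≡ 6 or 8 ℕ.≤ ℓ) → Openings G
  bySize ℓ∈ v≡ (inj₁ refl)        = openFour ℓ∈ (trans v≡ (ℤ.+-identityˡ _))
  bySize ℓ∈ v≡ (inj₂ (inj₁ refl)) = atLeast6 ℓ∈ v≡ ℕ.≤-refl
  bySize ℓ∈ v≡ (inj₂ (inj₂ 8≤))   = atLeast6 ℓ∈ v≡ (ℕ.≤-trans (ℕ.m≤n+m 6 2) 8≤)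
  cases : BestOpening G → Openings G
  cases (empty eq _)          = contradiction (components≡[]⇒count≡0 G eq) (chain⇒count≢0 G n∈)
  cases (openChain {c} c∈ v≡) = byLength c∈ v≡ (c ℕ.≟ 3)
  cases (openLoop ℓ∈ v≡)      = bySize ℓ∈ v≡ (loopCases (All.lookup (loopsOK G) ℓ∈))

2≤v-no4 : ∀ G → LongChains G → ∀ {n} → n ∈ chains G → ¬ 4 ∈ loops G → + 2 ≤ v G
2≤v-no4 G long n∈ no4 = cases (openings G n∈)
  where
  cases : Openings G → + 2 ≤ v G
  cases (openThree 3∈ _) = contradiction (All.lookup long 3∈) λ { (s≤s (s≤s (s≤s ()))) }
  cases (openFour 4∈ _)  = contradiction 4∈ no4
  cases (openOther 2≤)   = 2≤

∈-─⁻ : ∀ {x y : ℕ} {xs} (x∈ : x ∈ xs) → y ∈ (xs Any.─ x∈) → y ∈ xs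
∈-─⁻ x∈ y∈ = ↭.∈-resp-↭ (↭-sym (─-↭ x∈)) (there y∈)

-- Bounded integers in a form that can be matched on or handed to the decision procedure `allUpTo?`.
Small : ℕ → ℤ → Set
Small k i = ∃[ m ] i ≡ + m × m ℕ.≤ k

small : ∀ {k i} → + 0 ≤ i → i ≤ + k → Small k i
small {i = + m} _ (+≤+ m≤k) = m , refl , m≤k

≰⇒≤1 : ∀ {i} → ¬ + 2 ≤ i → i ≤ + 1
≰⇒≤1 2≰i = ℤ.i<j⇒i≤pred[j] (ℤ.≰⇒> 2≰i)

-- By `4≤κ`, a `κ` of at most 1 forces a 4-loop or a 6-loop. The rest of a 4-loop is worth some x
-- from 0 to 5, so |x - 4| is at most 4. If there are only 6-loops, the rest of one is worth 2 to 4,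
-- where the lower bound needs the absence of 4-loops, and 2 + |x - 4| is at most 4.
long-v≤4 : ∀ k G → count G ≡ k → LongChains G → ∀ {n} → n ∈ chains G → κ G ≤ + 1 → v G ≤ + 4
long-v≤4 zero    G count≡ long n∈ κ≤1 = contradiction count≡ (chain⇒count≢0 G n∈)
long-v≤4 (suc k) G count≡ long n∈ κ≤1 = go (4 ∈? loops G) (6 ∈? loops G)
  where
  v-rest≤ : ∀ {ℓ} (ℓ∈ : ℓ ∈ loops G) {b} → 4 ℕ.≤ b → κ (G ∖loop ℓ∈) ≤ + b → v (G ∖loop ℓ∈) ≤ + b
  v-rest≤ ℓ∈ 4≤b κ≤b with + 2 ℤ.≤? κ (G ∖loop ℓ∈)
  ... | yes 2≤κ = ℤ.≤-trans (ℤ.≤-reflexive (long-v≡κ (G ∖loop ℓ∈) long n∈ 2≤κ)) κ≤b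
  ... | no  2≰κ = ℤ.≤-trans (long-v≤4 k (G ∖loop ℓ∈) (count-∖loop G ℓ∈ count≡) long n∈ (≰⇒≤1 2≰κ)) (+≤+ 4≤b)
  open4 : (4∈ : 4 ∈ loops G) → Small 5 (v (G ∖loop 4∈)) → v G ≤ + 4
  open4 4∈ (m , eq , m≤5) = ℤ.≤-trans (v-≤-loop G 4∈)
    (subst (λ x → openValue (loopOf 4) x ≤ + 4) (sym eq) (table (s≤s m≤5)))
    where
    table : ∀ {m} → m ℕ.< 6 → openValue (loopOf 4) (+ m) ≤ + 4
    table = from-yes (ℕ.allUpTo? (λ m → openValue (loopOf 4) (+ m) ℤ.≤? + 4) 6)
  open6 : ¬ 4 ∈ loops G → (6∈ : 6 ∈ loops G) → Small 4 (v (G ∖loop 6∈)) → v G ≤ + 4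
  open6 4∉ 6∈ (m , eq , m≤4) = ℤ.≤-trans (v-≤-loop G 6∈)
    (subst (λ x → openValue (loopOf 6) x ≤ + 4) (sym eq) (table (s≤s m≤4)
      (ℤ.drop‿+≤+ (subst (+ 2 ≤_) eq (2≤v-no4 (G ∖loop 6∈) long n∈ λ 4∈ → 4∉ (∈-─⁻ 6∈ 4∈))))))
    where
    table : ∀ {m} → m ℕ.< 5 → 2 ℕ.≤ m → openValue (loopOf 6) (+ m) ≤ + 4
    table = from-yes (ℕ.allUpTo? (λ m → 2 ℕ.≤? m →-dec openValue (loopOf 6) (+ m) ℤ.≤? + 4) 5)
  go : Dec (4 ∈ loops G) → Dec (6 ∈ loops G) → v G ≤ + 4
  go (yes 4∈) _ = open4 4∈ (small (v-nonNegative (G ∖loop 4∈)) (v-rest≤ 4∈ {5} (ℕ.n≤1+n 4)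
    (ℤ.≤-trans (ℤ.≤-reflexive (κ-∖loop G 4∈)) (ℤ.+-monoˡ-≤ (+ 4) κ≤1))))
  go (no 4∉) (yes 6∈) = open6 4∉ 6∈ (small (v-nonNegative (G ∖loop 6∈)) (v-rest≤ 6∈ {4} ℕ.≤-refl
    (ℤ.≤-trans (ℤ.≤-reflexive (κ-∖loop G 6∈)) (ℤ.≤-trans (ℤ.+-monoˡ-≤ (+ 2) κ≤1) (+≤+ (ℕ.n≤1+n 3))))))
  go (no 4∉) (no 6∉) = contradiction (ℤ.≤-trans (4≤κ G long (noShortLoops G 4∉ 6∉)) κ≤1) λ { (+≤+ (s≤s ())) }

-- Endgames with exactly one 3-chain and a longer chain

numberOf-─ : ∀ {x xs} (x∈ : x ∈ xs) → numberOf x xs ≡ suc (numberOf x (xs Any.─ x∈))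
numberOf-─ {x} x∈ = trans (↭.↭-length (↭.filter-↭ (ℕ._≟ x) (─-↭ x∈))) (cong length (List.filter-accept (ℕ._≟ x) refl))

numberOf≡0⇒∉ : ∀ {x xs} → numberOf x xs ≡ 0 → ¬ x ∈ xs
numberOf≡0⇒∉ n≡0 x∈ with trans (sym n≡0) (numberOf-─ x∈)
... | ()

numberOf⇒∈ : ∀ {x k} xs → numberOf x xs ≡ suc k → x ∈ xs
numberOf⇒∈ {x} xs n≡ with x ∈? xs
... | yes x∈ = x∈
... | no  x∉ with trans (sym n≡) (cong length (List.filter-none (ℕ._≟ x) (All.tabulate λ y∈ y≡x → x∉ (subst (_∈ xs) y≡x y∈))))
...   | ()

-- The hypotheses on the chains, stated for the endgame `A` without the 3-chain: the results on
-- `LongChains` apply to `A`, and all fields survive the removal of a loop unchanged.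
record Mixed (G : SimpleLoonyEndgame) : Set where
  field
    3∈      : 3 ∈ chains G
    one     : LongChains (G ∖chain 3∈)
    {long}  : ℕ
    long∈   : long ∈ chains (G ∖chain 3∈)

  A : SimpleLoonyEndgame
  A = G ∖chain 3∈

  κ-A : κ A ≡ κ G + + 1
  κ-A = κ-∖chain G 3∈

  v-A : (3∈′ : 3 ∈ chains G) → v (G ∖chain 3∈′) ≡ v A
  v-A 3∈′ = v-↭ (G ∖chain 3∈′) A (↭.drop-∷ (↭-trans (↭-sym (components-∖chain G 3∈′)) (components-∖chain G 3∈)))

-- Needed because `_∖loop_` depends on the membership proof, and the optimal opening comes with its
-- own.
v-∖4 : ∀ G (4∈ 4∈′ : 4 ∈ loops G) → v (G ∖loop 4∈) ≡ v (G ∖loop 4∈′)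
v-∖4 G 4∈ 4∈′ = v-↭ (G ∖loop 4∈) (G ∖loop 4∈′)
  (↭.drop-∷ (↭-trans (↭-sym (components-∖loop G 4∈)) (components-∖loop G 4∈′)))

mixed-∖loop : ∀ {G} → Mixed G → ∀ {ℓ} (ℓ∈ : ℓ ∈ loops G) → Mixed (G ∖loop ℓ∈)
mixed-∖loop M ℓ∈ = record { 3∈ = M.3∈ ; one = M.one ; long∈ = M.long∈ }
  where module M = Mixed M

mixed : ∀ G → 3 ∈ chains G → numberOf 3 (chains G) ≡ 1 → Any (4 ℕ.≤_) (chains G) → Mixed G
mixed G 3∈ number≡1 any4 = record { 3∈ = 3∈ ; one = one ; long∈ = proj₂ longChain }
  where
  3∉rest : ¬ 3 ∈ chains (G ∖chain 3∈)
  3∉rest = numberOf≡0⇒∉ (ℕ.suc-injective (trans (sym (numberOf-─ 3∈)) number≡1))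
  one : LongChains (G ∖chain 3∈)
  one = All.tabulate λ c∈ → ℕ.≤∧≢⇒< (All.lookup (chains≥3 G) (∈-─⁻ 3∈ c∈)) λ { refl → 3∉rest c∈ }
  longChain : ∃[ c ] c ∈ chains (G ∖chain 3∈)
  longChain with ↭.Any-resp-↭ (─-↭ 3∈) any4
  ... | here (s≤s (s≤s (s≤s ())))
  ... | there any4′ = let c , c∈ , _ = find any4′ in c , c∈

cv≡κ : ∀ G → Any (4 ℕ.≤_) (chains G) → cv G ≡ κ G
cv≡κ G any4 = cong (λ b → fcv G + b) (bonus (chains G) (loops G) any4)
  where
  bonus : ∀ cs ls → Any (4 ℕ.≤_) cs → terminalBonus cs ls ≡ + 4
  bonus (_ ∷ _)    []      _ = refl
  bonus cs@(_ ∷ _) (_ ∷ _) p with any? (4 ℕ.≤?_) cs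
  ... | yes _ = refl
  ... | no ¬p = contradiction p ¬p

¬even-1 : ¬ Even (+ 1)
¬even-1 e = from-no (2 ℕ.∣? 1) (even⇒∣ e)

¬even-3 : ¬ Even (+ 3)
¬even-3 e = from-no (2 ℕ.∣? 3) (even⇒∣ e)

even-shift : ∀ {i j} → Even (i + j) → Even j → Even i
even-shift {i} {j} e e′ = subst Even (lemma i j) (even-- e e′)
  where
  lemma : ∀ i j → i + j - j ≡ i
  lemma = solve-∀

mixed-chain : ∀ {G} (M : Mixed G) → Mixed.long M ∈ chains G
mixed-chain M = ∈-─⁻ (Mixed.3∈ M) (Mixed.long∈ M)

-- Opening the 3-chain attains the lower bound: `A` has a `κ` larger by 1, so its value is known and
-- exceeds 2.
mixed-v≡κ : ∀ {G} → Mixed G → + 2 ≤ κ G → v G ≡ κ G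
mixed-v≡κ {G} M 2≤κ = ℤ.≤-antisym (ℤ.≤-trans (v-≤-chain G 3∈) (ℤ.≤-reflexive (trans
    (cong (openValue (chainOf 3)) (long-v≡κ A one long∈ 2≤κA)) (openChain-∖ G 3∈ 2≤κA))))
  (κ≤v G (mixed-chain M))
  where
  open Mixed M
  2≤κA : + 2 ≤ κ A
  2≤κA = ℤ.≤-trans (ℤ.≤-trans 2≤κ (ℤ.i≤i+j (κ G) (+ 1))) (ℤ.≤-reflexive (sym κ-A))

v-A≤4 : ∀ {G} (M : Mixed G) → κ G ≤ + 1 → Small 4 (v (Mixed.A M))
v-A≤4 {G} M κ≤1 = small (v-nonNegative A) (go (+ 2 ℤ.≤? κ A))
  where
  open Mixed M
  go : Dec (+ 2 ≤ κ A) → v A ≤ + 4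
  go (yes 2≤κ) = ℤ.≤-trans (ℤ.≤-reflexive (trans (long-v≡κ A one long∈ 2≤κ) κ-A))
    (ℤ.≤-trans (ℤ.+-monoˡ-≤ (+ 1) κ≤1) (+≤+ (s≤s (s≤s z≤n))))
  go (no 2≰κ) = long-v≤4 _ A refl one long∈ (≰⇒≤1 2≰κ)

mixed-v≤3 : ∀ {G} → Mixed G → κ G ≤ + 1 → Small 3 (v G)
mixed-v≤3 {G} M κ≤1 = small (v-nonNegative G) (ℤ.≤-trans (v-≤-chain G 3∈) (bound (v-A≤4 M κ≤1)))
  where
  open Mixed M
  table : ∀ {m} → m ℕ.< 5 → openValue (chainOf 3) (+ m) ≤ + 3
  table = from-yes (ℕ.allUpTo? (λ m → openValue (chainOf 3) (+ m) ℤ.≤? + 3) 5)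
  bound : Small 4 (v A) → openValue (chainOf 3) (v A) ≤ + 3
  bound (m , eq , m≤4) = subst (λ x → openValue (chainOf 3) x ≤ + 3) (sym eq) (table (s≤s m≤4))

even-v : ∀ {G} → Mixed G → κ G ≤ + 1 → Even (κ G) → v G ≡ + 0 or v G ≡ + 2
even-v {G} M κ≤1 even = cases (mixed-v≤3 M κ≤1)
  where
  cases : Small 3 (v G) → v G ≡ + 0 or v G ≡ + 2
  cases (0 , v≡ , _) = inj₁ v≡
  cases (1 , v≡ , _) = ⊥-elim (¬even-1 (subst Even v≡ (κ-even⇒v-even G even)))
  cases (2 , v≡ , _) = inj₂ v≡
  cases (3 , v≡ , _) = ⊥-elim (¬even-3 (subst Even v≡ (κ-even⇒v-even G even)))
  cases (suc (suc (suc (suc _))) , _ , s≤s (s≤s (s≤s ())))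

odd-v : ∀ {G} → Mixed G → κ G ≤ + 1 → ¬ Even (κ G) → v G ≡ + 1 or v G ≡ + 3
odd-v {G} M κ≤1 odd = cases (mixed-v≤3 M κ≤1)
  where
  cases : Small 3 (v G) → v G ≡ + 1 or v G ≡ + 3
  cases (0 , v≡ , _) = ⊥-elim (odd (v-even⇒κ-even G (+ 0 , v≡)))
  cases (1 , v≡ , _) = inj₁ v≡
  cases (2 , v≡ , _) = ⊥-elim (odd (v-even⇒κ-even G (+ 1 , v≡)))
  cases (3 , v≡ , _) = inj₂ v≡
  cases (suc (suc (suc (suc _))) , _ , s≤s (s≤s (s≤s ())))

exceptional-v : ∀ {G} → Mixed G → (4∈ : 4 ∈ loops G) → κ (G ∖loop 4∈) ≡ + 4 → v G ≡ + 0
exceptional-v {G} M 4∈ κ≡4 = ℤ.≤-antisym (ℤ.≤-trans (v-≤-loop G 4∈) (ℤ.≤-reflexive (cong (openValue (loopOf 4))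
    (trans (mixed-v≡κ (mixed-∖loop M 4∈) (subst (+ 2 ≤_) (sym κ≡4) (+≤+ (s≤s (s≤s z≤n))))) κ≡4))))
  (v-nonNegative G)

-- Only a 4-loop whose rest is worth 4 can be opened at value 0. That rest again has one 3-chain,
-- and 4 exceeds the bound 3 for `κ` at most 1, so its `κ` is its value.
unexceptional-v : ∀ {G} → Mixed G → v G ≡ + 0 → ∃[ 4∈ ] κ (_∖loop_ {4} G 4∈) ≡ + 4
unexceptional-v {G} M v≡0 = cases (openings G (mixed-chain M))
  where
  small-rest : (4∈ : 4 ∈ loops G) → v (G ∖loop 4∈) ≡ + 4 → Small 3 (v (G ∖loop 4∈)) → κ (G ∖loop 4∈) ≡ + 4
  small-rest 4∈ v≡4 (m , eq , m≤3) with trans (sym eq) v≡4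
  ... | refl = contradiction m≤3 λ { (s≤s (s≤s (s≤s ()))) }
  κ-rest : (4∈ : 4 ∈ loops G) → v (G ∖loop 4∈) ≡ + 4 → Dec (+ 2 ≤ κ (G ∖loop 4∈)) → κ (G ∖loop 4∈) ≡ + 4
  κ-rest 4∈ v≡4 (yes 2≤κ) = trans (sym (mixed-v≡κ (mixed-∖loop M 4∈) 2≤κ)) v≡4
  κ-rest 4∈ v≡4 (no 2≰κ)  = small-rest 4∈ v≡4 (mixed-v≤3 (mixed-∖loop M 4∈) (≰⇒≤1 2≰κ))
  cases : Openings G → ∃[ 4∈ ] κ (_∖loop_ {4} G 4∈) ≡ + 4
  cases (openThree 3∈ v≡) = contradiction (trans (sym v≡0) v≡) λ ()
  cases (openOther 2≤v)   = contradiction (subst (+ 2 ≤_) v≡0 2≤v) λ { (+≤+ ()) }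
  cases (openFour 4∈ v≡)  = 4∈ , κ-rest 4∈
    (ℤ.i-j≡0⇒i≡j _ _ (ℤ.∣i∣≡0⇒i≡0 (ℤ.+-injective (trans (sym v≡) v≡0)))) (+ 2 ℤ.≤? κ (G ∖loop 4∈))

-- Removing the 3-chain flips the parity of `κ`. This excludes 1 and 3 as values of `A` when `κ G`
-- is odd.
even-A-shift : ∀ {G} (M : Mixed G) j → v (Mixed.A M) ≡ j + j + + 1 → Even (κ G)
even-A-shift {G} M j v≡ = subst Even
  (trans (cong₂ (λ x k → j + j - (x - k)) v≡ κ-A) (lemma (κ G) j)) (even-- (j , refl) (v-κ-even _ A refl))
  where
  open Mixed M
  lemma : ∀ k j → j + j - (j + j + + 1 - (k + + 1)) ≡ k
  lemma = solve-∀

odd-v-A : ∀ {G} (M : Mixed G) → κ G ≤ + 1 → ¬ Even (κ G) → v (Mixed.A M) ≢ + 2 →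
  v (Mixed.A M) ≡ + 0 or v (Mixed.A M) ≡ + 4
odd-v-A {G} M κ≤1 odd v≢2 = cases (v-A≤4 M κ≤1)
  where
  open Mixed M
  cases : Small 4 (v A) → v A ≡ + 0 or v A ≡ + 4
  cases (0 , v≡ , _) = inj₁ v≡
  cases (1 , v≡ , _) = ⊥-elim (odd (even-A-shift M (+ 0) v≡))
  cases (2 , v≡ , _) = contradiction v≡ v≢2
  cases (3 , v≡ , _) = ⊥-elim (odd (even-A-shift M (+ 1) v≡))
  cases (4 , v≡ , _) = inj₂ v≡
  cases (suc (suc (suc (suc (suc _)))) , _ , s≤s (s≤s (s≤s (s≤s ()))))

open3-≡3 : ∀ {x} → x ≡ + 0 or x ≡ + 4 → + 1 + + ∣ x - + 2 ∣ ≡ + 3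
open3-≡3 (inj₁ refl) = refl
open3-≡3 (inj₂ refl) = refl

at-most-1 : ∀ {i} → i ≡ + 1 or i ≡ + 3 → i ≤ + 1 → i ≡ + 1
at-most-1 (inj₁ i≡1)  _ = i≡1
at-most-1 (inj₂ refl) (+≤+ (s≤s ()))

v-when-A≡2 : ∀ {G} (M : Mixed G) → κ G ≤ + 1 → ¬ Even (κ G) → v (Mixed.A M) ≡ + 2 → v G ≡ + 1
v-when-A≡2 {G} M κ≤1 odd v≡2 = at-most-1 (odd-v M κ≤1 odd)
  (subst (λ x → v G ≤ openValue (chainOf 3) x) v≡2 (v-≤-chain G (Mixed.3∈ M)))

-- No opening is worth 1: the 3-chain costs 1 + 2 because `A` is worth 0 or 4, a 4-loop costs |1 -
-- 4|, and all others at least 2. Without 4-loops the last hypothesis is vacuous, which is case (d).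
v≡3-if-rest≡1 : ∀ {G} (M : Mixed G) → κ G ≤ + 1 → ¬ Even (κ G) → v (Mixed.A M) ≢ + 2 →
  (∀ 4∈ → v (_∖loop_ {4} G 4∈) ≡ + 1) → v G ≡ + 3
v≡3-if-rest≡1 {G} M κ≤1 odd v≢2 vH≡1 = cases (odd-v M κ≤1 odd)
  where
  byOpening : Openings G → v G ≡ + 1 → v G ≡ + 3
  byOpening (openThree 3∈ v≡) _   = trans v≡ (trans
    (cong (λ x → + 1 + + ∣ x - + 2 ∣) (Mixed.v-A M 3∈)) (open3-≡3 (odd-v-A M κ≤1 odd v≢2)))
  byOpening (openFour 4∈ v≡)  _   = trans v≡ (cong (λ x → + ∣ x - + 4 ∣) (vH≡1 4∈))
  byOpening (openOther 2≤v)   v≡1 = contradiction (subst (+ 2 ≤_) v≡1 2≤v) λ { (+≤+ (s≤s ())) }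
  cases : v G ≡ + 1 or v G ≡ + 3 → v G ≡ + 3
  cases (inj₁ v≡1) = byOpening (openings G (mixed-chain M)) v≡1
  cases (inj₂ v≡3) = v≡3

-- The values that can remain after one 4-loop is removed from an endgame with odd `κ` at most 1: 1
-- or 3 if `κ` is still at most 1, and otherwise the new `κ`, which is 3 or 5.
data OneThreeFive : ℤ → Set where
  is1 : OneThreeFive (+ 1)
  is3 : OneThreeFive (+ 3)
  is5 : OneThreeFive (+ 5)

-- For x = 3 or 5 opening the 4-loop yields 1, the least value of the right parity; for x = 1 it
-- yields 3, and no opening yields 1.
v-via-4 : ∀ {G} (M : Mixed G) → κ G ≤ + 1 → ¬ Even (κ G) → v (Mixed.A M) ≢ + 2 → (4∈ : 4 ∈ loops G) →
  ∀ {x} → v (G ∖loop 4∈) ≡ x → OneThreeFive x → v G ≡ + ∣ x - + 4 ∣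
v-via-4 {G} M κ≤1 odd v≢2 4∈ vH≡ x∈ = go x∈ vH≡ (subst (λ x → v G ≤ openValue (loopOf 4) x) vH≡ (v-≤-loop G 4∈))
  where
  go : ∀ {x} → OneThreeFive x → v (G ∖loop 4∈) ≡ x → v G ≤ openValue (loopOf 4) x → v G ≡ + ∣ x - + 4 ∣
  go is1 vH≡1 _  = v≡3-if-rest≡1 M κ≤1 odd v≢2 λ 4∈′ → trans (v-∖4 G 4∈′ 4∈) vH≡1
  go is3 _    le = at-most-1 (odd-v M κ≤1 odd) le
  go is5 _    le = at-most-1 (odd-v M κ≤1 odd) le

-- Carries the hypothesis of case (e) through the induction. If `A` without a 4-loop were worth 2,
-- opening that loop would show `v A` to be at most 2, which excludes 4; and 0 would require a
-- 4-loop whose rest is worth 4.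
v-A-∖4 : ∀ {G} (M : Mixed G) → κ G ≤ + 1 → ¬ Even (κ G) → v (Mixed.A M) ≢ + 2 → (4∈ : 4 ∈ loops G) →
  v (Mixed.A (mixed-∖loop M 4∈)) ≢ + 2
v-A-∖4 {G} M κ≤1 odd v≢2 4∈ vAH≡2 = absurd (odd-v-A M κ≤1 odd v≢2)
  where
  open Mixed M
  vA∖4≡2 : v (A ∖loop 4∈) ≡ + 2
  vA∖4≡2 = trans (v-↭ (A ∖loop 4∈) (Mixed.A (mixed-∖loop M 4∈)) ↭-refl) vAH≡2
  vA≢0 : v A ≢ + 0
  vA≢0 v≡0 = cases (openings A long∈)
    where
    cases : ¬ Openings A
    cases (openThree 3∈′ v≡) = contradiction (trans (sym v≡0) v≡) λ ()
    cases (openOther 2≤v)    = contradiction (subst (+ 2 ≤_) v≡0 2≤v) λ { (+≤+ ()) }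
    cases (openFour 4∈′ v≡)  = contradiction
      (trans (sym v≡0) (trans v≡ (cong (λ x → + ∣ x - + 4 ∣) (trans (v-∖4 A 4∈′ 4∈) vA∖4≡2)))) λ ()
  absurd : ¬ (v A ≡ + 0 or v A ≡ + 4)
  absurd (inj₁ v≡0) = vA≢0 v≡0
  absurd (inj₂ v≡4) = contradiction (subst₂ _≤_ v≡4 (cong (openValue (loopOf 4)) vA∖4≡2) (v-≤-loop A 4∈))
    λ { (+≤+ (s≤s (s≤s ()))) }

-- Removing the 4-loops one at a time

-- The value in case (e) for f + 1 4-loops: while κ ≤ 1, opening a 4-loop reflects the value in 4.
reflected : ℕ → ℕ → ℤ
reflected zero    d = + ∣ + 4 - + d ∣
reflected (suc f) d = + 4 - reflected f d

reflected-twice : ∀ f d → reflected (suc (suc f)) d ≡ reflected f d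
reflected-twice f d = lemma (reflected f d)
  where
  lemma : ∀ i → + 4 - (+ 4 - i) ≡ i
  lemma = solve-∀

reflected-odd : ∀ f d → ¬ 2 ℕ.∣ suc f → reflected f d ≡ + ∣ + 4 - + d ∣
reflected-odd 0             d 2∤ = refl
reflected-odd 1             d 2∤ = contradiction (ℕ.divides 1 refl) 2∤
reflected-odd (suc (suc f)) d 2∤ = trans (reflected-twice f d)
  (reflected-odd f d λ 2∣ → 2∤ (ℕ.∣m∣n⇒∣m+n ℕ.∣-refl 2∣))

reflected-even : ∀ f d → 2 ℕ.∣ suc f → reflected f d ≡ + 4 - + ∣ + 4 - + d ∣
reflected-even 0             d 2∣ = contradiction 2∣ (from-no (2 ℕ.∣? 1))
reflected-even 1             d 2∣ = refl
reflected-even (suc (suc f)) d 2∣ = trans (reflected-twice f d)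
  (reflected-even f d (ℕ.∣m+n∣m⇒∣n 2∣ ℕ.∣-refl))

-- For the point where removing a 4-loop lifts `κ` to `r`, which is 3 or 5. Each of the `f`
-- remaining 4-loops has lowered `κ` by 4, so `K` is worth `r + 4f`. Modulo 8 this has period 2 in
-- `f`, as has `reflected`; hence two initial cases suffice.
reflected-≡1 : ∀ r → reflected 0 (r % 8) ≡ + 1 → reflected 1 ((r ℕ.+ 4) % 8) ≡ + 1 →
  ∀ f → reflected f ((r ℕ.+ 4 ℕ.* f) % 8) ≡ + 1
reflected-≡1 r eq₀ eq₁ 0 = trans (cong (λ k → reflected 0 (k % 8)) (ℕ.+-identityʳ r)) eq₀
reflected-≡1 r eq₀ eq₁ 1 = eq₁
reflected-≡1 r eq₀ eq₁ (suc (suc f)) = trans (reflected-twice f ((r ℕ.+ 4 ℕ.* suc (suc f)) % 8))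
  (trans (cong (reflected f) (trans (cong (_% 8) (lemma r f)) ([m+n]%n≡m%n (r ℕ.+ 4 ℕ.* f) 8)))
    (reflected-≡1 r eq₀ eq₁ f))
  where
  lemma : ∀ r f → r ℕ.+ 4 ℕ.* suc (suc f) ≡ r ℕ.+ 4 ℕ.* f ℕ.+ 8
  lemma = ℕ.solve-∀

withoutLoops-∖4 : ∀ G (4∈ : 4 ∈ loops G) → v (withoutLoops 4 G) ≡ v (withoutLoops 4 (G ∖loop 4∈))
withoutLoops-∖4 G 4∈ = v-↭ (withoutLoops 4 G) (withoutLoops 4 (G ∖loop 4∈))
  (↭.++⁺ˡ (map chainOf (chains G)) (↭.map⁺ loopOf (↭-trans (↭.filter-↭ others (─-↭ 4∈))
    (↭-reflexive (List.filter-reject others {xs = loops G Any.─ 4∈} λ 4≢4 → 4≢4 refl)))))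
  where others = λ ℓ → ¬? (ℓ ℕ.≟ 4)

withoutLoops-none : ∀ G → ¬ 4 ∈ loops G → v (withoutLoops 4 G) ≡ v G
withoutLoops-none G 4∉ = v-↭ (withoutLoops 4 G) G
  (↭-reflexive (cong (λ ls → map chainOf (chains G) ++ map loopOf ls)
    (List.filter-all (λ ℓ → ¬? (ℓ ℕ.≟ 4)) (All.tabulate λ { ℓ∈ refl → 4∉ ℓ∈ }))))

κ-withoutLoops : ∀ G → κ (withoutLoops 4 G) ≡ κ G + + (4 ℕ.* numberOf 4 (loops G))
κ-withoutLoops G = trans (cong (λ s → a + s + + 4) (go (loops G))) (lemma a _ _)
  where
  a = ∑ (map (λ c → + c - + 4) (chains G))
  f : ℕ → ℤ
  f ℓ = + ℓ - + 8
  others = λ ℓ → ¬? (ℓ ℕ.≟ 4)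
  lemma : ∀ a s k → a + (s + k) + + 4 ≡ a + s + + 4 + k
  lemma = solve-∀
  go : ∀ ls → ∑ (map f (filter others ls)) ≡ ∑ (map f ls) + + (4 ℕ.* numberOf 4 ls)
  go []       = refl
  go (ℓ ∷ ls) = cases (ℓ ℕ.≟ 4)
    where
    cases : Dec (ℓ ≡ 4) → ∑ (map f (filter others (ℓ ∷ ls))) ≡ f ℓ + ∑ (map f ls) + + (4 ℕ.* numberOf 4 (ℓ ∷ ls))
    cases (yes refl) = trans (go ls) (trans (lemma₁ (∑ (map f ls)) (+ (4 ℕ.* numberOf 4 ls)))
      (cong (λ k → f 4 + ∑ (map f ls) + + k) (sym (ℕ.*-suc 4 (numberOf 4 ls)))))
      where
      lemma₁ : ∀ s k → s + k ≡ - + 4 + s + (+ 4 + k)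
      lemma₁ = solve-∀
    cases (no ℓ≢4) = trans (cong (λ xs → ∑ (map f xs)) (List.filter-accept others ℓ≢4))
      (trans (cong (λ s → f ℓ + s) (go ls)) (trans (sym (ℤ.+-assoc (f ℓ) _ _))
        (cong (λ xs → f ℓ + ∑ (map f ls) + + (4 ℕ.* length xs)) (sym (List.filter-reject (ℕ._≟ 4) ℓ≢4)))))

-- Induction on the number of 4-loops in `H`, which is `G` less one of them. It stops when `κ H` is
-- at least 2, where `mixed-v≡κ` gives both `v H` and `v K`, or when `H` has no 4-loop and so has
-- the components of `K`. Otherwise `v H` is 1 or 3, and |v H - 4| = 4 - v H is the recursion of
-- `reflected`.
v-with-4 : ∀ f {G} (M : Mixed G) → numberOf 4 (loops G) ≡ suc f → κ G ≤ + 1 → ¬ Even (κ G) →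
  v (Mixed.A M) ≢ + 2 → v G ≡ reflected f (v (withoutLoops 4 G) %ℕ 8)
v-with-4 f {G} M number≡ κ≤1 odd v≢2 = go (+ 2 ℤ.≤? κ H)
  where
  4∈ : 4 ∈ loops G
  4∈ = numberOf⇒∈ (loops G) number≡
  H = G ∖loop 4∈
  K = withoutLoops 4 H
  MH : Mixed H
  MH = mixed-∖loop M 4∈
  MK : Mixed K
  MK = record { 3∈ = Mixed.3∈ MH ; one = Mixed.one MH ; long∈ = Mixed.long∈ MH }
  numberH : numberOf 4 (loops H) ≡ f
  numberH = ℕ.suc-injective (trans (sym (numberOf-─ 4∈)) number≡)
  oddH : ¬ Even (κ H)
  oddH e = odd (even-shift (subst Even (κ-∖loop G 4∈) e) (+ 2 , refl))
  conclude : ∀ {x} → v H ≡ x → OneThreeFive x → + ∣ x - + 4 ∣ ≡ reflected f (v K %ℕ 8) →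
    v G ≡ reflected f (v (withoutLoops 4 G) %ℕ 8)
  conclude vH≡ x∈ eq = trans (v-via-4 M κ≤1 odd v≢2 4∈ vH≡ x∈)
    (trans eq (cong (λ x → reflected f (x %ℕ 8)) (sym (withoutLoops-∖4 G 4∈))))
  large : ∀ r → κ H ≡ + r → 2 ℕ.≤ r → v H ≡ + r × v K ≡ + (r ℕ.+ 4 ℕ.* f)
  large r κH≡ 2≤r = trans (mixed-v≡κ MH (subst (+ 2 ≤_) (sym κH≡) (+≤+ 2≤r))) κH≡
    , trans (mixed-v≡κ MK (subst (+ 2 ≤_) (sym κK≡) (+≤+ (ℕ.≤-trans 2≤r (ℕ.m≤m+n r _))))) κK≡
    where
    κK≡ : κ K ≡ + (r ℕ.+ 4 ℕ.* f)
    κK≡ = trans (κ-withoutLoops H) (cong₂ (λ x k → x + + (4 ℕ.* k)) κH≡ numberH)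
  go : Dec (+ 2 ≤ κ H) → v G ≡ reflected f (v (withoutLoops 4 G) %ℕ 8)
  -- `κ H` is odd and at most 1 + 4, so only 3 and 5 remain, and either makes `G` worth 1.
  go (yes 2≤κ) = cases (small {5} (ℤ.≤-trans (+≤+ z≤n) 2≤κ)
    (ℤ.≤-trans (ℤ.≤-reflexive (κ-∖loop G 4∈)) (ℤ.+-monoˡ-≤ (+ 4) κ≤1)))
    where
    ended : ∀ r → reflected f ((r ℕ.+ 4 ℕ.* f) % 8) ≡ + 1 → v K ≡ + (r ℕ.+ 4 ℕ.* f) →
      + 1 ≡ reflected f (v K %ℕ 8)
    ended r eq vK≡ = trans (sym eq) (cong (λ x → reflected f (x %ℕ 8)) (sym vK≡))
    cases : Small 5 (κ H) → v G ≡ reflected f (v (withoutLoops 4 G) %ℕ 8)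
    cases (0 , κ≡ , _) = contradiction (subst (+ 2 ≤_) κ≡ 2≤κ) λ { (+≤+ ()) }
    cases (1 , κ≡ , _) = contradiction (subst (+ 2 ≤_) κ≡ 2≤κ) λ { (+≤+ (s≤s ())) }
    cases (2 , κ≡ , _) = ⊥-elim (oddH (+ 1 , κ≡))
    cases (3 , κ≡ , _) = let vH≡ , vK≡ = large 3 κ≡ (s≤s (s≤s z≤n)) in
      conclude vH≡ is3 (ended 3 (reflected-≡1 3 refl refl f) vK≡)
    cases (4 , κ≡ , _) = ⊥-elim (oddH (+ 2 , κ≡))
    cases (5 , κ≡ , _) = let vH≡ , vK≡ = large 5 κ≡ (s≤s (s≤s z≤n)) in
      conclude vH≡ is5 (ended 5 (reflected-≡1 5 refl refl f) vK≡)
    cases (suc (suc (suc (suc (suc (suc _))))) , _ , s≤s (s≤s (s≤s (s≤s (s≤s ())))))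
  go (no 2≰κ) = byNumber f refl (odd-v MH κH≤1 oddH)
    where
    κH≤1 = ≰⇒≤1 2≰κ
    byNumber : ∀ f′ → f ≡ f′ → v H ≡ + 1 or v H ≡ + 3 → v G ≡ reflected f (v (withoutLoops 4 G) %ℕ 8)
    byNumber zero refl vH∈ = base vH∈
      where
      vK≡vH : v K ≡ v H
      vK≡vH = withoutLoops-none H (numberOf≡0⇒∉ numberH)
      base : v H ≡ + 1 or v H ≡ + 3 → v G ≡ reflected 0 (v (withoutLoops 4 G) %ℕ 8)
      base (inj₁ vH≡) = conclude vH≡ is1 (cong (λ x → reflected 0 (x %ℕ 8)) (sym (trans vK≡vH vH≡)))
      base (inj₂ vH≡) = conclude vH≡ is3 (cong (λ x → reflected 0 (x %ℕ 8)) (sym (trans vK≡vH vH≡)))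
    byNumber (suc f′) refl vH∈ = step vH∈
      where
      ih : v H ≡ reflected f′ (v K %ℕ 8)
      ih = v-with-4 f′ MH numberH κH≤1 oddH (v-A-∖4 M κ≤1 odd v≢2 4∈)
      step : v H ≡ + 1 or v H ≡ + 3 → v G ≡ reflected (suc f′) (v (withoutLoops 4 G) %ℕ 8)
      step (inj₁ vH≡) = conclude vH≡ is1 (cong (λ i → + 4 - i) (trans (sym vH≡) ih))
      step (inj₂ vH≡) = conclude vH≡ is3 (cong (λ i → + 4 - i) (trans (sym vH≡) ih))

-- The five cases put together

corollary27 :
  (G : SimpleLoonyEndgame) →
  (three : 3 ∈ chains G) → numberOf 3 (chains G) ≡ 1 →
  Any (4 ℕ.≤_) (chains G) →
  let c = cv G
      f = numberOf 4 (loops G)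
      K = withoutLoops 4 G
      d = v K %ℕ 8
      exception = ∃[ four ] cv (_∖loop_ {4} G four) ≡ + 4
  in
    (+ 2 ≤ c → v G ≡ c)
  × (c ≤ + 1 → + 2 ∣ c →
       (¬ exception → v G ≡ + 2) × (exception → v G ≡ + 0))
  × (c ≤ + 1 → ¬ (+ 2 ∣ c) → v (G ∖chain three) ≡ + 2 → v G ≡ + 1)
  × (c ≤ + 1 → ¬ (+ 2 ∣ c) → v (G ∖chain three) ≢ + 2 → ¬ (4 ∈ loops G) →
       v G ≡ + 3)
  × (c ≤ + 1 → ¬ (+ 2 ∣ c) → v (G ∖chain three) ≢ + 2 → 1 ℕ.≤ f →
       (¬ (2 ℕ.∣ f) → v G ≡ + ∣ + 4 - + d ∣)
     × (2 ℕ.∣ f → v G ≡ + 4 - + ∣ + 4 - + d ∣))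
corollary27 G 3∈ number≡1 any4 rewrite cv≡κ G any4 =
    mixed-v≡κ M
  , (λ κ≤1 2∣κ →
        (λ unexceptional → Sum.fromInj₂ (λ v≡0 → ⊥-elim (unexceptional (exception⁺ (unexceptional-v M v≡0))))
          (even-v M κ≤1 (∣⇒even 2∣κ)))
      , λ { (4∈ , cv≡4) → exceptional-v M 4∈ (trans (sym (cv≡κ (G ∖loop 4∈) any4)) cv≡4) })
  , (λ κ≤1 odd → v-when-A≡2 M κ≤1 (¬even odd))
  , (λ κ≤1 odd v≢2 4∉ → v≡3-if-rest≡1 M κ≤1 (¬even odd) v≢2 λ 4∈ → contradiction 4∈ 4∉)
  , (λ κ≤1 odd v≢2 1≤f → byNumber κ≤1 (¬even odd) v≢2 1≤f (numberOf 4 (loops G)) refl)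
  where
  M : Mixed G
  M = mixed G 3∈ number≡1 any4
  ¬even : ¬ (+ 2 ∣ κ G) → ¬ Even (κ G)
  ¬even 2∤κ e = 2∤κ (even⇒∣ e)
  exception⁺ : ∃[ 4∈ ] κ (_∖loop_ {4} G 4∈) ≡ + 4 → ∃[ 4∈ ] cv (_∖loop_ {4} G 4∈) ≡ + 4
  exception⁺ (4∈ , κ≡4) = 4∈ , trans (cv≡κ (G ∖loop 4∈) any4) κ≡4
  byNumber : κ G ≤ + 1 → ¬ Even (κ G) → v (G ∖chain 3∈) ≢ + 2 → 1 ℕ.≤ numberOf 4 (loops G) →
    ∀ f → numberOf 4 (loops G) ≡ f →
    (¬ (2 ℕ.∣ numberOf 4 (loops G)) → v G ≡ + ∣ + 4 - + (v (withoutLoops 4 G) %ℕ 8) ∣)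
    × (2 ℕ.∣ numberOf 4 (loops G) → v G ≡ + 4 - + ∣ + 4 - + (v (withoutLoops 4 G) %ℕ 8) ∣)
  byNumber κ≤1 odd v≢2 1≤f zero    eq = contradiction (subst (1 ℕ.≤_) eq 1≤f) λ ()
  byNumber κ≤1 odd v≢2 1≤f (suc f) eq =
      (λ 2∤ → trans v≡ (reflected-odd f _ (subst (λ k → ¬ 2 ℕ.∣ k) eq 2∤)))
    , (λ 2∣ → trans v≡ (reflected-even f _ (subst (2 ℕ.∣_) eq 2∣)))
    where
    v≡ : v G ≡ reflected f (v (withoutLoops 4 G) %ℕ 8)
    v≡ = v-with-4 f M eq κ≤1 odd v≢2
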